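{- Let $\xi\in\mathbb{F}_q^{\mathrm{alg}}\subset\mathbb{C}_\infty$ (the algebraic closure of $\mathbb{F}_q$ in $\mathbb{C}_\infty$) satisfy $\xi^{q^r}=\xi$ for an integer $r>0$. Then $$L(\chi_\xi,1)=-\frac{\widetilde{\pi}}{\rho_\xi},$$ where $\rho_\xi\neq0$ is the root $\rho_\xi=(\tau s_{\mathrm{Car}})(\xi)\in\mathbb{C}_\infty$ of the polynomial equation $$X^{q^r-1}=(\xi-\theta^{q^r})(\xi-\theta^{q^{r-1}})\cdots(\xi-\theta^q).$$
   Context: Let $q=p^e$ be a power of a prime $p$ ($e>0$), $A=\mathbb{F}_q[\theta]$ with $\theta$ an indeterminate, $K=\mathbb{F}_q(\theta)$, with absolute value $|a|=q^{\deg_\theta a}$, so $|\theta|=q$. Let $K_\infty=\mathbb{F}_q((1/\theta))$ be the completion of $K$, and $\mathbb{C}_\infty$ the completion of an algebraic closure of $K_\infty$. $A^+$ is the set of monic polynomials of $A$. For $a\in A$, $\chi_\xi(a)=a(\xi)$ is the result of substituting $\xi$ for $\theta$ in $a$, and $L(\chi_\xi,1)=\sum_{a\in A^+}\chi_\xi(a)a^{ -1}$, which converges in $\mathbb{C}_\infty$. Carlitz exponential: $e_{\mathrm{Car}}(\eta)=\sum_{n\ge0}\eta^{q^n}/d_n$, where $d_0=1$, $d_i=[i][i-1]^q\cdots[1]^{q^{i-1}}$ and $[i]=\theta^{q^i}-\theta$ for $i>0$. $\widetilde{\pi}$ is a fixed fundamental period of $e_{\mathrm{Car}}$ (a generator of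 the $A$-module $\ker e_{\mathrm{Car}}$), given, for a choice of a $(q-1)$-th root of $-\theta$, by $\widetilde{\pi}=\theta(-\theta)^{1/(q-1)}\prod_{i\ge1}(1-\theta^{1-q^i})^{ -1}$. $s_{\mathrm{Car}}(t)=\sum_{i=0}^\infty e_{\mathrm{Car}}(\widetilde{\pi}/\theta^{i+1})t^i=\sum_{n=0}^\infty\frac{\widetilde{\pi}^{q^n}}{d_n(\theta^{q^n}-t)}$, which converges for $|t|<q$. The operator $\tau$ acts on $\mathbb{C}_\infty((t))$ by $\tau\sum c_it^i=\sum c_i^qt^i$; one has $\tau s_{\mathrm{Car}}=(t-\theta)s_{\mathrm{Car}}$. -}

module Defs where

open import Level using (Level; _⊔_) renaming (suc to lsuc)
open import Algebra.Bundles using (CommutativeRing; Semiring)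
open import Algebra.Morphism.Structures using (IsRingHomomorphism)
import Algebra.Definitions.RawSemiring as RawSemiringDefs
open import Data.Fin.Base using (Fin; toℕ)
open import Data.Integer.Base using (+_)
open import Data.List.Base using (List; _∷_; _∷ʳ_; foldr; map; length)
open import Data.List.Relation.Binary.Equality.Setoid using (≋-setoid)
import Data.List.Relation.Binary.Subset.Setoid as Subset
import Data.List.Relation.Unary.Unique.Setoid as Unique
open import Data.Maybe.Base using (zipWith)
open import Data.Nat.Base as ℕ using (ℕ; suc)
open import Data.Product using (∃-syntax; _×_)
open import Data.Rational.Base as ℚ using (ℚ)
open import Function.Base using (_∘_; id)
open import Function.Bundles using (Inverse; _⇔_)
open import Relation.Binary.Bundles using (Setoid)
open import Relation.Binary.Construct.Add.Infimum.NonStrict ℚ._≤_ using (_≤₋_)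
open import Relation.Binary.PropositionalEquality using (_≡_; setoid)
open import Relation.Nullary.Construct.Add.Infimum using (_₋; ⊥₋; [_])
open import Relation.Nullary.Negation using (¬_)

-- Inversion is a total operation with the convention 0⁻¹ = 0.
record Field (c ℓ : Level) : Set (lsuc (c ⊔ ℓ)) where
  field
    commutativeRing : CommutativeRing c ℓ

  open CommutativeRing commutativeRing public
  open RawSemiringDefs (Semiring.rawSemiring semiring) public
    using (_^_; sum; product)

  infix 8 _⁻¹
  infixl 7 _/_

  field
    _⁻¹      : Carrier → Carrier
    ⁻¹-cong  : ∀ {x y} → x ≈ y → x ⁻¹ ≈ y ⁻¹
    1≉0      : ¬ 1# ≈ 0#
    inverseʳ : ∀ {x} → ¬ x ≈ 0# → x * x ⁻¹ ≈ 1#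
    0⁻¹≈0    : 0# ⁻¹ ≈ 0#

  _/_ : Carrier → Carrier → Carrier
  x / y = x * y ⁻¹

  -- Σ< n f = f 0 + ⋯ + f (n - 1), and similarly for products.
  Σ< : ℕ → (ℕ → Carrier) → Carrier
  Σ< n f = sum {n} (f ∘ toℕ)

  ∏< : ℕ → (ℕ → Carrier) → Carrier
  ∏< n f = product {n} (f ∘ toℕ)

-- a₀ ∷ a₁ ∷ ⋯ ∷ [] stands for a₀ + a₁X + ⋯ ; trailing zeros are allowed.
Poly : ∀ {c ℓ} → Field c ℓ → Set c
Poly F = List (Field.Carrier F)

-- A monic polynomial of degree d is given by its d coefficients below the
-- leading one, so this representation is unique.
MonicPoly : ∀ {c ℓ} → Field c ℓ → Set c
MonicPoly F = List (Field.Carrier F)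

MonicPolySetoid : ∀ {c ℓ} → Field c ℓ → Setoid c (c ⊔ ℓ)
MonicPolySetoid F = ≋-setoid (Field.setoid F)

monic : ∀ {c ℓ} (F : Field c ℓ) → MonicPoly F → Poly F
monic F as = as ∷ʳ Field.1# F

module _ {c ℓ} (F E : Field c ℓ) where
  private
    module F = Field F
    module E = Field E

  IsFieldHom : (F.Carrier → E.Carrier) → Set (c ⊔ ℓ)
  IsFieldHom = IsRingHomomorphism F.rawRing E.rawRing

  eval : (F.Carrier → E.Carrier) → Poly F → E.Carrier → E.Carrier
  eval φ as x = foldr (λ a v → φ a E.+ x E.* v) E.0# as

  IsAlgebraic : (F.Carrier → E.Carrier) → E.Carrier → Set (c ⊔ ℓ)
  IsAlgebraic φ x = ∃[ as ] eval φ (monic F as) x E.≈ E.0#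

IsAlgebraicallyClosed : ∀ {c ℓ} → Field c ℓ → Set (c ⊔ ℓ)
IsAlgebraicallyClosed E =
  ∀ a as → ∃[ x ] eval E E id (monic E (a ∷ as)) x ≈ 0#
  where open Field E

-- The absolute value is recorded through its logarithm: |x| = q ^ deg x,
-- with deg 0 = -∞ = ⊥₋.  Rational exponents suffice because the value group
-- of an algebraic closure of 𝔽_q((1/θ)), and hence of its completion, is q^ℚ.
record ValuedField (c ℓ : Level) : Set (lsuc (c ⊔ ℓ)) where
  field
    underlying : Field c ℓ

  open Field underlying public

  field
    deg      : Carrier → ℚ ₋
    deg-cong : ∀ {x y} → x ≈ y → deg x ≡ deg y
    deg-zero : ∀ x → deg x ≡ ⊥₋ ⇔ x ≈ 0#
    deg-*    : ∀ x y → deg (x * y) ≡ zipWith ℚ._+_ (deg x) (deg y)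
    deg-+    : ∀ x y r → deg x ≤₋ r → deg y ≤₋ r → deg (x + y) ≤₋ r

  infix 4 _⟶_

  -- deg is a logarithm, so "arbitrarily small" means "below every r ∈ ℚ".
  _⟶_ : (ℕ → Carrier) → Carrier → Set
  u ⟶ l = ∀ r → ∃[ N ] ∀ n → N ℕ.≤ n → deg (u n - l) ≤₋ [ r ]

  IsCauchy : (ℕ → Carrier) → Set
  IsCauchy u =
    ∀ r → ∃[ N ] ∀ m n → N ℕ.≤ m → N ℕ.≤ n → deg (u m - u n) ≤₋ [ r ]

  IsComplete : Set c
  IsComplete = ∀ u → IsCauchy u → ∃[ l ] u ⟶ l

  IsSeriesSum : (ℕ → Carrier) → Carrier → Set
  IsSeriesSum f s = (λ n → Σ< n f) ⟶ s

  IsInfiniteProduct : (ℕ → Carrier) → Carrier → Set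
  IsInfiniteProduct f s = (λ n → ∏< n f) ⟶ s

  -- s is the sum of the family f: the net of its finite partial sums,
  -- indexed by the finite subsets of I, converges to s.
  IsFamilySum : ∀ {i j} (I : Setoid i j) → (Setoid.Carrier I → Carrier) →
                Carrier → Set (i ⊔ j)
  IsFamilySum I f s =
    ∀ r → ∃[ S₀ ] ∀ S → Unique.Unique I S → Subset._⊆_ I S₀ S →
    deg (foldr _+_ 0# (map f S) - s) ≤₋ [ r ]

module _ {c ℓ} (K L : ValuedField c ℓ) where
  private
    module K = ValuedField K
    module L = ValuedField L

  record IsValuedExtension (φ : K.Carrier → L.Carrier) : Set (c ⊔ ℓ) where
    field
      isFieldHom : IsFieldHom K.underlying L.underlying φ
      isometric  : ∀ x → L.deg (φ x) ≡ K.deg x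

  record IsCompletion (φ : K.Carrier → L.Carrier) : Set (c ⊔ ℓ) where
    field
      isValuedExtension : IsValuedExtension φ
      complete          : L.IsComplete
      dense             : ∀ y r → ∃[ x ] L.deg (y L.- φ x) ≤₋ [ r ]

  record IsAlgebraicClosure (φ : K.Carrier → L.Carrier) : Set (c ⊔ ℓ) where
    field
      isValuedExtension : IsValuedExtension φ
      algebraic         : ∀ y → IsAlgebraic K.underlying L.underlying φ y
      closed            : IsAlgebraicallyClosed L.underlying

-- 𝔽_q ⊂ K = 𝔽_q(θ) ⊂ K∞ = 𝔽_q((1/θ)) ⊂ K∞alg ⊂ ℂ∞, each stage given by the
-- property that determines it up to isomorphism.
record CarlitzTower (c ℓ : Level) (q : ℕ) : Set (lsuc (c ⊔ ℓ)) where
  field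
    𝔽q            : Field c ℓ
    K K∞ K∞alg ℂ∞ : ValuedField c ℓ

  module 𝔽q = Field 𝔽q
  module K = ValuedField K
  module K∞ = ValuedField K∞
  module K∞alg = ValuedField K∞alg
  module ℂ∞ = ValuedField ℂ∞

  field
    𝔽q-card : Inverse 𝔽q.setoid (setoid (Fin q))

    𝔽q→K     : 𝔽q.Carrier → K.Carrier
    𝔽q→K-hom : IsFieldHom 𝔽q K.underlying 𝔽q→K
    θK       : K.Carrier

  evalK : Poly 𝔽q → K.Carrier
  evalK a = eval 𝔽q K.underlying 𝔽q→K a θK

  field
    -- |a| = q ^ deg_θ a for nonzero a ∈ A; in particular θ is transcendental.
    deg-poly : ∀ as b → ¬ b 𝔽q.≈ 𝔽q.0# →
               K.deg (evalK (as ∷ʳ b)) ≡ [ + length as ℚ./ 1 ]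
    fraction : ∀ x → ∃[ a ] ∃[ b ]
               ¬ evalK b K.≈ K.0# × x K.≈ evalK a K./ evalK b

    K→K∞     : K.Carrier → K∞.Carrier
    K∞→K∞alg : K∞.Carrier → K∞alg.Carrier
    K∞alg→ℂ∞ : K∞alg.Carrier → ℂ∞.Carrier

    K∞-isCompletion    : IsCompletion K K∞ K→K∞
    K∞alg-isAlgClosure : IsAlgebraicClosure K∞ K∞alg K∞→K∞alg
    ℂ∞-isCompletion    : IsCompletion K∞alg ℂ∞ K∞alg→ℂ∞

  ι : 𝔽q.Carrier → ℂ∞.Carrier
  ι = K∞alg→ℂ∞ ∘ K∞→K∞alg ∘ K→K∞ ∘ 𝔽q→K

  θ : ℂ∞.Carrier
  θ = (K∞alg→ℂ∞ ∘ K∞→K∞alg ∘ K→K∞) θK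

module Carlitz {c ℓ} {q : ℕ} (T : CarlitzTower c ℓ q) where
  open CarlitzTower T public using (𝔽q; ι; θ)
  open ValuedField (CarlitzTower.ℂ∞ T) public

  infix 9 _⟨_⟩

  _⟨_⟩ : Poly 𝔽q → Carrier → Carrier
  a ⟨ x ⟩ = eval 𝔽q underlying ι a x

  bracket : ℕ → Carrier
  bracket i = θ ^ (q ℕ.^ i) - θ

  -- [i] [i-1]^q ⋯ [1]^(q^(i-1))
  d : ℕ → Carrier
  d i = ∏< i (λ j → bracket (i ℕ.∸ j) ^ (q ℕ.^ j))

  -- Sums of convergent series are given by relations; this one says that
  -- y = e_Car(η).
  IsCarlitzExp : Carrier → Carrier → Set
  IsCarlitzExp η y = IsSeriesSum (λ n → η ^ (q ℕ.^ n) / d n) y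

  -- ker e_Car = A π̃, together with the product formula for some choice of
  -- (q-1)-th root of -θ.
  record IsFundamentalPeriod (π̃ : Carrier) : Set (c ⊔ ℓ) where
    field
      kernel  : ∀ η → IsCarlitzExp η 0# ⇔ (∃[ a ] η ≈ a ⟨ θ ⟩ * π̃)
      root    : Carrier
      isRoot  : root ^ (q ℕ.∸ 1) ≈ - θ
      prod    : Carrier
      isProd  : IsInfiniteProduct
                  (λ i → (1# - θ / θ ^ (q ℕ.^ suc i)) ⁻¹) prod
      formula : π̃ ≈ θ * root * prod

  -- Coefficients of an element of ℂ∞[[t]] ⊂ ℂ∞((t)).
  PowerSeries : Set c
  PowerSeries = ℕ → Carrier

  τ : PowerSeries → PowerSeries
  τ f i = f i ^ q

  HasValueAt : PowerSeries → Carrier → Carrier → Set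
  HasValueAt f x y = IsSeriesSum (λ i → f i * x ^ i) y

  -- s = s_Car, for the choice π̃ of the period
  IsSCar : Carrier → PowerSeries → Set
  IsSCar π̃ s = ∀ i → IsCarlitzExp (π̃ / θ ^ suc i) (s i)

  χ : Carrier → Poly 𝔽q → Carrier
  χ ξ a = a ⟨ ξ ⟩

  -- l = L(χ_ξ, 1) = ∑_{a ∈ A⁺} χ_ξ(a) a⁻¹
  IsLValue : Carrier → Carrier → Set (c ⊔ ℓ)
  IsLValue ξ l =
    IsFamilySum (MonicPolySetoid 𝔽q)
      (λ a → χ ξ (monic 𝔽q a) / monic 𝔽q a ⟨ θ ⟩) l

-- Put t = ξ, θ_i = θ^(q^i), and let S_d be the sum of a(t)/a(θ) over monic a of
-- degree d.  Adjoining one coefficient of a at a time, Newton interpolation at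
-- θ, θ^q, θ^(q²), … together with the Artin–Schreier sum
-- ∑_{c ∈ 𝔽_q} 1/(x + c) = -1/(x^q - x) gives
-- S_d = ∏_{i<d} (t - θ_i) / ∏_{1≤i≤d} (θ - θ_i), and these telescope to
-- ∑_{d≤n} S_d = ∏_{1≤i≤n} (t - θ_i)/(θ - θ_i).
--
-- For ψ = τ s_Car the relation ψ(x)^q = (x^q - θ^q) ψ(x^q) gives
-- ρ^(q^n) = ρ ∏_{1≤i≤n} (ξ - θ_i) whenever ξ^(q^n) = ξ, in particular for n = r.
-- With σ = λ^q, λ the chosen root of λ^(q-1) = -θ, the n-th partial sum is then
-- w⁻¹ w^(q^n) ∏_{1≤i≤n} (1 - θ/θ_i)⁻¹ with w = ρ/σ.  As |w - 1| < 1 the factor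
-- w^(q^n) tends to 1, so the limit along multiples n of r is -π̃/ρ.
module Submission where

open import Defs
open import Level using (Level; _⊔_)
open import Algebra.Bundles using (CommutativeMonoid; CommutativeRing)
import Algebra.Morphism.Construct.Composition as Composition
open import Algebra.Morphism.Structures using (IsRingHomomorphism)
import Algebra.Properties.CommutativeSemiring.Exp
import Algebra.Properties.Group
import Algebra.Properties.Ring
import Algebra.Properties.Semiring.Mult.TCOptimised
import Algebra.Solver.Ring
open import Algebra.Solver.Ring.AlmostCommutativeRing using (fromCommutativeRing; _-Raw-AlmostCommutative⟶_)
open import Data.Fin.Base using (Fin)
import Data.Fin.Properties as Fin
open import Data.Integer.Base as ℤ using (ℤ; 0ℤ; 1ℤ)
import Data.Integer.Properties as ℤ
open import Data.List.Base using (List; []; _∷_; _∷ʳ_; _++_; cartesianProductWith; foldr; length; map; tabulate)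
import Data.List.Membership.Setoid as Membership
import Data.List.Membership.Setoid.Properties as Membershipₚ
import Data.List.Properties as List
import Data.List.Relation.Binary.Equality.Setoid as ListEquality
import Data.List.Relation.Binary.Permutation.Setoid as Permutation
import Data.List.Relation.Binary.Permutation.Setoid.Properties as Permutationₚ
open import Data.List.Relation.Binary.Pointwise as Pointwise using ([]; _∷_)
import Data.List.Relation.Binary.Subset.Setoid as Subset
open import Data.List.Relation.Unary.All as All using (All; []; _∷_)
import Data.List.Relation.Unary.All.Properties as All
open import Data.List.Relation.Unary.AllPairs as AllPairs using ([]; _∷_)
open import Data.List.Relation.Unary.Any as Any using (here; there)
import Data.List.Relation.Unary.Unique.Setoid as Unique
import Data.List.Relation.Unary.Unique.Setoid.Properties as Uniqueₚ
import Data.Maybe.Base as Maybe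
open import Data.Maybe.Base using (just; nothing; zipWith)
open import Data.Maybe.Properties using (just-injective)
open import Data.Nat.Base as ℕ using (ℕ; zero; suc; _≤_; s≤s; z≤n)
open import Data.Nat.Primality using (Prime)
import Data.Nat.Properties as ℕ
open import Data.Product using (∃-syntax; _×_; _,_; proj₁; proj₂)
open import Data.Rational.Base as ℚ using (ℚ; 0ℚ; 1ℚ; mkℚ)
import Data.Rational.Properties as ℚ
open import Data.Rational.Unnormalised.Base as ℚᵘ using (mkℚᵘ; *≤*; *≡*)
import Data.Rational.Unnormalised.Properties as ℚᵘ
open import Data.Sum.Base using (inj₁; inj₂)
open import Function.Base using (_∘_; case_of_)
open import Function.Bundles using (Equivalence; Inverse)
open import Relation.Binary.Bundles using (Setoid)
open import Relation.Binary.Construct.Add.Infimum.NonStrict ℚ._≤_ using (_≤₋_; ⊥₋≤_; [_]; [≤]-injective; ≤₋-trans)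
open import Relation.Binary.Core using (_Preserves_⟶_)
open import Relation.Binary.Definitions using (Decidable)
open import Relation.Binary.PropositionalEquality as ≡ using (_≡_)
import Relation.Binary.Reasoning.Setoid
open import Relation.Nullary.Construct.Add.Infimum using (_₋)
open import Relation.Nullary.Decidable using (Dec; yes; no; map′)
open import Relation.Nullary.Decidable.Core using (dec⇒maybe)
open import Relation.Nullary.Negation using (¬_; contradiction)

-- The bound |w - 1| < 1 comes from the coefficients of s_Car: |s_0 - λ| ≤ 1 and |s_(i+1)| ≤ q^(-i),
-- so |ρ - σ| ≤ 1, whereas |σ| ≥ q. The same comparison gives ρ ≠ 0. A limit along multiples of r
-- settles the convergence of the whole net because |a(ξ)/a(θ)| ≤ q^(-deg a): once the sum over
-- degrees ≤ n is within q^(-k) of the limit for a single n ≥ k, so is the sum over every larger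
-- finite set. Absolute values here are fractional powers of q; for instance |λ| = q^(1/(q-1)). All
-- estimates are upper bounds |x| ≤ q^(-n) with n natural: large quantities enter through quotients
-- such as λ/θ, and roots are controlled through their powers. The additivity of Frobenius and the
-- power sum behind the Artin-Schreier sum are identities of degree below q in one variable; each is
-- checked on the q elements of 𝔽_q and extended to ℂ∞ by counting roots.

module IntegerSolver {c ℓ} (R : CommutativeRing c ℓ) where
  open import Data.Integer.Base using (+_; -[1+_])
  open CommutativeRing R
  open Algebra.Properties.Ring ring
  open Algebra.Properties.Semiring.Mult.TCOptimised semiring
    using (×-homo-+; ×1-homo-*; 1+×) renaming (_×_ to _·_)
  open import Relation.Binary.Reasoning.Setoid setoid

  private
    -- Integers give the solver coefficients with decidable equality, which `R` may lack. With this
    -- form of multiples `1 · 1#` reduces to `1#`, so `con 1ℤ` means `1#` on the nose.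
    ⟦_⟧ : ℤ → Carrier
    ⟦ + n ⟧      = n · 1#
    ⟦ -[1+ n ] ⟧ = - (suc n · 1#)

    cancel : ∀ x y z → (z + x) - (z + y) ≈ x - y
    cancel x y z = begin
      (z + x) - (z + y)        ≈⟨ +-cong (+-comm z x) (-‿cong (+-comm z y)) ⟩
      (x + z) - (y + z)        ≈⟨ +-congˡ (-‿+-comm y z) ⟨
      (x + z) + (- y + - z)    ≈⟨ +-congˡ (+-comm (- y) (- z)) ⟩
      (x + z) + (- z + - y)    ≈⟨ +-assoc (x + z) (- z) (- y) ⟨
      ((x + z) + - z) + - y    ≈⟨ +-congʳ (trans (+-assoc x z (- z)) (trans (+-congˡ (-‿inverseʳ z)) (+-identityʳ x))) ⟩
      x - y                    ∎

    ⟦⊖⟧ : ∀ m n → ⟦ m ℤ.⊖ n ⟧ ≈ m · 1# - n · 1#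
    ⟦⊖⟧ m zero = sym (trans (+-congˡ -0#≈0#) (+-identityʳ _))
    ⟦⊖⟧ zero (suc n) = sym (+-identityˡ _)
    ⟦⊖⟧ (suc m) (suc n) = begin
      ⟦ suc m ℤ.⊖ suc n ⟧                ≡⟨ ≡.cong ⟦_⟧ (ℤ.[1+m]⊖[1+n]≡m⊖n m n) ⟩
      ⟦ m ℤ.⊖ n ⟧                        ≈⟨ ⟦⊖⟧ m n ⟩
      m · 1# - n · 1#                    ≈⟨ cancel _ _ 1# ⟨
      (1# + m · 1#) - (1# + n · 1#)      ≈⟨ +-cong (1+× m 1#) (-‿cong (1+× n 1#)) ⟨
      suc m · 1# - suc n · 1#            ∎

    neg-homo : ∀ i → ⟦ ℤ.- i ⟧ ≈ - ⟦ i ⟧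
    neg-homo (+ zero)  = sym -0#≈0#
    neg-homo (+ suc n) = refl
    neg-homo -[1+ n ]  = sym (-‿involutive _)

    +-homo : ∀ i j → ⟦ i ℤ.+ j ⟧ ≈ ⟦ i ⟧ + ⟦ j ⟧
    +-homo (+ m)    (+ n)    = ×-homo-+ 1# m n
    +-homo (+ m)    -[1+ n ] = ⟦⊖⟧ m (suc n)
    +-homo -[1+ m ] (+ n)    = trans (⟦⊖⟧ n (suc m)) (+-comm _ _)
    +-homo -[1+ m ] -[1+ n ] = begin
      - (suc (suc (m ℕ.+ n)) · 1#)          ≡⟨ ≡.cong (λ k → - (k · 1#)) (≡.cong suc (ℕ.+-suc m n)) ⟨
      - ((suc m ℕ.+ suc n) · 1#)            ≈⟨ -‿cong (×-homo-+ 1# (suc m) (suc n)) ⟩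
      - (suc m · 1# + suc n · 1#)           ≈⟨ -‿+-comm _ _ ⟨
      - (suc m · 1#) + - (suc n · 1#)       ∎

    *-homo⁺ : ∀ m j → ⟦ + m ℤ.* j ⟧ ≈ ⟦ + m ⟧ * ⟦ j ⟧
    *-homo⁺ m (+ n) = begin
      ⟦ + m ℤ.* + n ⟧      ≡⟨ ≡.cong ⟦_⟧ (ℤ.pos-* m n) ⟨
      (m ℕ.* n) · 1#       ≈⟨ ×1-homo-* m n ⟩
      m · 1# * n · 1#      ∎
    *-homo⁺ m -[1+ n ] = begin
      ⟦ + m ℤ.* -[1+ n ] ⟧           ≡⟨ ≡.cong ⟦_⟧ (ℤ.neg-distribʳ-* (+ m) (+ suc n)) ⟨
      ⟦ ℤ.- (+ m ℤ.* + suc n) ⟧      ≈⟨ neg-homo (+ m ℤ.* + suc n) ⟩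
      - ⟦ + m ℤ.* + suc n ⟧          ≈⟨ -‿cong (*-homo⁺ m (+ suc n)) ⟩
      - (m · 1# * suc n · 1#)        ≈⟨ -‿distribʳ-* _ _ ⟩
      m · 1# * - (suc n · 1#)        ∎

    *-homo : ∀ i j → ⟦ i ℤ.* j ⟧ ≈ ⟦ i ⟧ * ⟦ j ⟧
    *-homo (+ m) j = *-homo⁺ m j
    *-homo -[1+ m ] j = begin
      ⟦ -[1+ m ] ℤ.* j ⟧             ≡⟨ ≡.cong ⟦_⟧ (ℤ.neg-distribˡ-* (+ suc m) j) ⟨
      ⟦ ℤ.- (+ suc m ℤ.* j) ⟧        ≈⟨ neg-homo (+ suc m ℤ.* j) ⟩
      - ⟦ + suc m ℤ.* j ⟧            ≈⟨ -‿cong (*-homo⁺ (suc m) j) ⟩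
      - (suc m · 1# * ⟦ j ⟧)         ≈⟨ -‿distribˡ-* _ _ ⟩
      - (suc m · 1#) * ⟦ j ⟧         ∎

    homomorphism : ℤ.+-*-rawRing -Raw-AlmostCommutative⟶ fromCommutativeRing R
    homomorphism = record
      { ⟦_⟧ = ⟦_⟧ ; +-homo = +-homo ; *-homo = *-homo
      ; -‿homo = neg-homo ; 0-homo = refl ; 1-homo = refl }

  open Algebra.Solver.Ring ℤ.+-*-rawRing (fromCommutativeRing R) homomorphism
    (λ i j → Maybe.map (λ i≡j → reflexive (≡.cong ⟦_⟧ i≡j)) (dec⇒maybe (i ℤ.≟ j)))
    public

-- Duplicate-free lists as finite subsets

module Sublist {a ℓ} (S : Setoid a ℓ) where
  open Setoid S
  open Membership S using (_∈_; _∉_)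
  open Permutation S using (_↭_; ↭-trans; ↭-refl; ↭-prep; ↭-reflexive-≋)
  open Permutationₚ S using (shift; ∈-resp-↭)
  open Subset S using (_⊆_)
  open Unique S using (Unique)

  ∈⇒↭ : ∀ {x ys} → x ∈ ys → ∃[ zs ] ys ↭ x ∷ zs
  ∈⇒↭ x∈ys with Membershipₚ.∈-∃++ S x∈ys
  ... | ys₁ , ys₂ , w , x≈w , ys≋ =
    ys₁ ++ ys₂ , ↭-trans (↭-reflexive-≋ ys≋) (shift (sym x≈w) ys₁ ys₂)

  -- Each entry of `xs` is pulled out of `ys` in turn; being distinct from the later ones, it leaves
  -- them in the remainder. This splits a finite set above `S₀` in `IsFamilySum` into `S₀` and a
  -- tail.
  unique-⊆⇒↭ : ∀ {xs ys} → Unique xs → xs ⊆ ys → ∃[ zs ] ys ↭ xs ++ zs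
  unique-⊆⇒↭ {[]} {ys} _ _ = ys , ↭-refl
  unique-⊆⇒↭ {x ∷ xs} {ys} (x∉xs ∷ xs!) xs⊆ys with ∈⇒↭ (xs⊆ys (here refl))
  ... | ys′ , ys↭ with unique-⊆⇒↭ xs! xs⊆ys′
    where
    xs⊆ys′ : xs ⊆ ys′
    xs⊆ys′ y∈xs with ∈-resp-↭ ys↭ (xs⊆ys (there y∈xs))
    ... | there y∈ys′ = y∈ys′
    ... | here y≈x = contradiction (Membershipₚ.∈-resp-≈ S y≈x y∈xs) (All.All¬⇒¬Any x∉xs)
  ... | zs , ys′↭ = zs , ↭-trans ys↭ (↭-prep x ys′↭)

  unique-++⇒∉ : ∀ xs {ys y} → Unique (xs ++ ys) → y ∈ ys → y ∉ xs
  unique-++⇒∉ (x ∷ xs) (x∉ ∷ _) y∈ys (here y≈x) =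
    All.All¬⇒¬Any x∉ (Membershipₚ.∈-++⁺ʳ S xs (Membershipₚ.∈-resp-≈ S y≈x y∈ys))
  unique-++⇒∉ (x ∷ xs) (_ ∷ xs!) y∈ys (there y∈xs) = unique-++⇒∉ xs xs! y∈ys y∈xs

-- Finite sums and products over lists

module ListFold {c ℓ} (M : CommutativeMonoid c ℓ) where
  open CommutativeMonoid M
  open import Relation.Binary.Reasoning.Setoid setoid

  -- For addition this is literally the partial sum occurring in `IsFamilySum`.
  fold : ∀ {i} {I : Set i} → List I → (I → Carrier) → Carrier
  fold is f = foldr _∙_ ε (map f is)

  private
    variable
      i j k : Level
      I : Set i
      J : Set j
      K : Set k

    interchange : ∀ w x y z → (w ∙ x) ∙ (y ∙ z) ≈ (w ∙ y) ∙ (x ∙ z)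
    interchange w x y z = begin
      (w ∙ x) ∙ (y ∙ z)  ≈⟨ assoc w x (y ∙ z) ⟩
      w ∙ (x ∙ (y ∙ z))  ≈⟨ ∙-congˡ (assoc x y z) ⟨
      w ∙ ((x ∙ y) ∙ z)  ≈⟨ ∙-congˡ (∙-congʳ (comm x y)) ⟩
      w ∙ ((y ∙ x) ∙ z)  ≈⟨ ∙-congˡ (assoc y x z) ⟩
      w ∙ (y ∙ (x ∙ z))  ≈⟨ assoc w y (x ∙ z) ⟨
      (w ∙ y) ∙ (x ∙ z)  ∎

  fold-cong : ∀ (is : List I) {f g} → (∀ i → f i ≈ g i) → fold is f ≈ fold is g
  fold-cong []       f≈g = refl
  fold-cong (i ∷ is) f≈g = ∙-cong (f≈g i) (fold-cong is f≈g)

  fold-cong-All : ∀ {is : List I} {f g} → All.All (λ i → f i ≈ g i) is → fold is f ≈ fold is g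
  fold-cong-All All.[]           = refl
  fold-cong-All (fi≈gi All.∷ eqs) = ∙-cong fi≈gi (fold-cong-All eqs)

  fold-ε : ∀ (is : List I) → fold is (λ _ → ε) ≈ ε
  fold-ε []       = refl
  fold-ε (i ∷ is) = trans (identityˡ _) (fold-ε is)

  fold-∙ : ∀ (is : List I) f g → fold is (λ i → f i ∙ g i) ≈ fold is f ∙ fold is g
  fold-∙ []       f g = sym (identityˡ ε)
  fold-∙ (i ∷ is) f g = trans (∙-congˡ (fold-∙ is f g)) (interchange _ _ _ _)

  fold-swap : ∀ (is : List I) (js : List J) (f : I → J → Carrier) →
              fold is (λ i → fold js (f i)) ≈ fold js (λ j → fold is (λ i → f i j))
  fold-swap []       js f = sym (fold-ε js)
  fold-swap (i ∷ is) js f = trans (∙-congˡ (fold-swap is js f)) (sym (fold-∙ js _ _))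

  fold-++ : ∀ (is js : List I) f → fold (is ++ js) f ≈ fold is f ∙ fold js f
  fold-++ []       js f = sym (identityˡ _)
  fold-++ (i ∷ is) js f = trans (∙-congˡ (fold-++ is js f)) (sym (assoc _ _ _))

  fold-map : ∀ (g : J → I) js f → fold (map g js) f ≈ fold js (λ j → f (g j))
  fold-map g []       f = refl
  fold-map g (j ∷ js) f = ∙-congˡ (fold-map g js f)

  fold-cartesianProductWith :
    ∀ (g : I → J → K) is js f →
    fold (cartesianProductWith g is js) f ≈ fold is (λ i → fold js (λ j → f (g i j)))
  fold-cartesianProductWith g []       js f = refl
  fold-cartesianProductWith g (i ∷ is) js f =
    trans (fold-++ (map (g i) js) _ f)
          (∙-cong (fold-map (g i) js f) (fold-cartesianProductWith g is js f))

  module _ (S : Setoid i j) where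
    open Setoid S using () renaming (_≈_ to _≈ˢ_)
    open Permutation S using (_↭_)

    fold-↭ : ∀ {is js f} → f Preserves _≈ˢ_ ⟶ _≈_ → is ↭ js → fold is f ≈ fold js f
    fold-↭ f-cong is↭js =
      Permutationₚ.foldr-commMonoid setoid isCommutativeMonoid
        (Permutationₚ.map⁺ S setoid f-cong is↭js)

-- Fields and polynomial functions

module FieldProperties {c ℓ} (F : Field c ℓ) where
  open Field F public
  open Algebra.Properties.Ring ring public
    using (-0#≈0#; -‿involutive; -‿distribˡ-*;
           [y-z]x≈yx-zx; x[y-z]≈xy-xz; +-cancelʳ)
    renaming (x∙y⁻¹≈ε⇒x≈y to x-y≈0⇒x≈y; x≈y⇒x∙y⁻¹≈ε to x≈y⇒x-y≈0)
  open Algebra.Properties.CommutativeSemiring.Exp commutativeSemiring public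
    using (^-congˡ; ^-congʳ; ^-assocʳ; ^-distrib-*)
  open IntegerSolver commutativeRing public
    using (solve; con; _:+_; _:*_; _:-_; :-_; _:=_)
  open ListFold +-commutativeMonoid public
    using () renaming (fold to ∑; fold-cong to ∑-cong; fold-cong-All to ∑-cong-All; fold-∙ to ∑-+; fold-swap to ∑-swap;
                       fold-++ to ∑-++; fold-map to ∑-map; fold-↭ to ∑-↭;
                       fold-cartesianProductWith to ∑-cartesianProductWith)
  open ListFold *-commutativeMonoid public
    using () renaming (fold to ∏; fold-∙ to ∏-*; fold-↭ to ∏-↭; fold-map to ∏-map)
  open import Relation.Binary.Reasoning.Setoid setoid

  inverseˡ : ∀ {x} → ¬ x ≈ 0# → x ⁻¹ * x ≈ 1#
  inverseˡ x≉0 = trans (*-comm _ _) (inverseʳ x≉0)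

  *-cancelˡ-nonzero : ∀ {x y z} → ¬ x ≈ 0# → x * y ≈ x * z → y ≈ z
  *-cancelˡ-nonzero {x} {y} {z} x≉0 xy≈xz = begin
    y               ≈⟨ *-identityˡ y ⟨
    1# * y          ≈⟨ *-congʳ (inverseˡ x≉0) ⟨
    x ⁻¹ * x * y    ≈⟨ *-assoc _ _ _ ⟩
    x ⁻¹ * (x * y)  ≈⟨ *-congˡ xy≈xz ⟩
    x ⁻¹ * (x * z)  ≈⟨ *-assoc _ _ _ ⟨
    x ⁻¹ * x * z    ≈⟨ *-congʳ (inverseˡ x≉0) ⟩
    1# * z          ≈⟨ *-identityˡ z ⟩
    z               ∎

  x≉0∧xy≈0⇒y≈0 : ∀ {x y} → ¬ x ≈ 0# → x * y ≈ 0# → y ≈ 0#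
  x≉0∧xy≈0⇒y≈0 x≉0 xy≈0 = *-cancelˡ-nonzero x≉0 (trans xy≈0 (sym (zeroʳ _)))

  *-nonzero : ∀ {x y} → ¬ x ≈ 0# → ¬ y ≈ 0# → ¬ x * y ≈ 0#
  *-nonzero x≉0 y≉0 xy≈0 = y≉0 (x≉0∧xy≈0⇒y≈0 x≉0 xy≈0)

  xy≈1⇒x≉0 : ∀ {x y} → x * y ≈ 1# → ¬ x ≈ 0#
  xy≈1⇒x≉0 xy≈1 x≈0 = 1≉0 (trans (sym xy≈1) (trans (*-congʳ x≈0) (zeroˡ _)))

  ⁻¹-unique : ∀ {x y} → x * y ≈ 1# → y ≈ x ⁻¹
  ⁻¹-unique xy≈1 = *-cancelˡ-nonzero x≉0 (trans xy≈1 (sym (inverseʳ x≉0)))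
    where x≉0 = xy≈1⇒x≉0 xy≈1

  ⁻¹-nonzero : ∀ {x} → ¬ x ≈ 0# → ¬ x ⁻¹ ≈ 0#
  ⁻¹-nonzero x≉0 = xy≈1⇒x≉0 (inverseˡ x≉0)

  ⁻¹-distrib-* : ∀ {x y} → ¬ x ≈ 0# → ¬ y ≈ 0# → (x * y) ⁻¹ ≈ x ⁻¹ * y ⁻¹
  ⁻¹-distrib-* {x} {y} x≉0 y≉0 = sym (⁻¹-unique (begin
    x * y * (x ⁻¹ * y ⁻¹)    ≈⟨ solve 4 (λ a b c d → a :* b :* (c :* d) := a :* c :* (b :* d)) refl x y (x ⁻¹) (y ⁻¹) ⟩
    x * x ⁻¹ * (y * y ⁻¹)    ≈⟨ *-cong (inverseʳ x≉0) (inverseʳ y≉0) ⟩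
    1# * 1#                  ≈⟨ *-identityˡ 1# ⟩
    1#                       ∎))

  1^n≈1 : ∀ n → 1# ^ n ≈ 1#
  1^n≈1 zero    = refl
  1^n≈1 (suc n) = trans (*-identityˡ _) (1^n≈1 n)

  ^-nonzero : ∀ {x} n → ¬ x ≈ 0# → ¬ x ^ n ≈ 0#
  ^-nonzero zero    x≉0 = 1≉0
  ^-nonzero (suc n) x≉0 = *-nonzero x≉0 (^-nonzero n x≉0)

  ^-⁻¹ : ∀ {x} n → ¬ x ≈ 0# → (x ⁻¹) ^ n ≈ (x ^ n) ⁻¹
  ^-⁻¹ {x} n x≉0 = ⁻¹-unique (begin
    x ^ n * (x ⁻¹) ^ n  ≈⟨ ^-distrib-* x (x ⁻¹) n ⟨
    (x * x ⁻¹) ^ n      ≈⟨ ^-congˡ n (inverseʳ x≉0) ⟩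
    1# ^ n              ≈⟨ 1^n≈1 n ⟩
    1#                  ∎)

  x≉0∧x^[1+n]≈x⇒x^n≈1 : ∀ {x} n → ¬ x ≈ 0# → x ^ suc n ≈ x → x ^ n ≈ 1#
  x≉0∧x^[1+n]≈x⇒x^n≈1 n x≉0 eq = *-cancelˡ-nonzero x≉0 (trans eq (sym (*-identityʳ _)))

  ∑-*ˡ : ∀ {i} {I : Set i} (is : List I) x f → ∑ is (λ i → x * f i) ≈ x * ∑ is f
  ∑-*ˡ []       x f = sym (zeroʳ x)
  ∑-*ˡ (i ∷ is) x f = trans (+-congˡ (∑-*ˡ is x f)) (sym (distribˡ x _ _))

  ∏-const : ∀ {i} {I : Set i} (is : List I) x → ∏ is (λ _ → x) ≈ x ^ length is
  ∏-const []       x = refl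
  ∏-const (_ ∷ is) x = *-congˡ (∏-const is x)

  ∏-nonzero : ∀ {xs} → All (λ x → ¬ x ≈ 0#) xs → ¬ ∏ xs (λ x → x) ≈ 0#
  ∏-nonzero []           = 1≉0
  ∏-nonzero (x≉0 ∷ xs≉0) = *-nonzero x≉0 (∏-nonzero xs≉0)

  -- PolyFun n f: the function f is given by a polynomial of degree < n.
  PolyFun : ℕ → (Carrier → Carrier) → Set (c ⊔ ℓ)
  PolyFun zero    f = ∀ x → f x ≈ 0#
  PolyFun (suc n) f = ∃[ a ] ∃[ g ] PolyFun n g × (∀ x → f x ≈ a + x * g x)

  PolyFun-resp : ∀ n {f g} → (∀ x → f x ≈ g x) → PolyFun n f → PolyFun n g
  PolyFun-resp zero    f≈g pf                = λ x → trans (sym (f≈g x)) (pf x)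
  PolyFun-resp (suc n) f≈g (a , h , ph , eq) = a , h , ph , λ x → trans (sym (f≈g x)) (eq x)

  PolyFun-0 : ∀ n → PolyFun n (λ _ → 0#)
  PolyFun-0 zero    x = refl
  PolyFun-0 (suc n) = 0# , _ , PolyFun-0 n , λ x → sym (trans (+-identityˡ _) (zeroʳ x))

  PolyFun-const : ∀ n a → PolyFun (suc n) (λ _ → a)
  PolyFun-const n a = a , _ , PolyFun-0 n , λ x → sym (trans (+-congˡ (zeroʳ x)) (+-identityʳ a))

  PolyFun-X* : ∀ n {f} → PolyFun n f → PolyFun (suc n) (λ x → x * f x)
  PolyFun-X* n pf = 0# , _ , pf , λ x → sym (+-identityˡ _)

  PolyFun-+ : ∀ n {f g} → PolyFun n f → PolyFun n g → PolyFun n (λ x → f x + g x)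
  PolyFun-+ zero    pf pg x = trans (+-cong (pf x) (pg x)) (+-identityˡ 0#)
  PolyFun-+ (suc n) (a , f , pf , f≈) (b , g , pg , g≈) =
    a + b , _ , PolyFun-+ n pf pg , λ x → trans (+-cong (f≈ x) (g≈ x))
      (solve 5 (λ a b x f g → a :+ x :* f :+ (b :+ x :* g) := a :+ b :+ x :* (f :+ g)) refl a b x (f x) (g x))

  PolyFun-* : ∀ n b {f} → PolyFun n f → PolyFun n (λ x → b * f x)
  PolyFun-* zero    b pf x = trans (*-congˡ (pf x)) (zeroʳ b)
  PolyFun-* (suc n) b (a , f , pf , f≈) =
    b * a , _ , PolyFun-* n b pf , λ x → trans (*-congˡ (f≈ x))
      (solve 4 (λ a b x f → b :* (a :+ x :* f) := b :* a :+ x :* (b :* f)) refl a b x (f x))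

  PolyFun-suc : ∀ n {f} → PolyFun n f → PolyFun (suc n) f
  PolyFun-suc zero    pf = PolyFun-resp 1 (λ x → sym (pf x)) (PolyFun-0 1)
  PolyFun-suc (suc n) (a , f , pf , f≈) = a , f , PolyFun-suc n pf , f≈

  PolyFun-[X+b]^ : ∀ b n → PolyFun (suc n) (λ x → (x + b) ^ n)
  PolyFun-[X+b]^ b zero    = PolyFun-const 0 1#
  PolyFun-[X+b]^ b (suc n) = PolyFun-resp (suc (suc n)) (λ x → sym (distribʳ _ x b))
    (PolyFun-+ (suc (suc n)) (PolyFun-X* (suc n) p) (PolyFun-suc (suc n) (PolyFun-* (suc n) b p)))
    where p = PolyFun-[X+b]^ b n

  -- The leading terms cancel: with D_n = (X + b)^n - X^n one has D_(n+1) = X D_n + b (X + b)^n. For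
  -- n = q the loss of one degree lets the q elements of 𝔽_q suffice as test points.
  PolyFun-[X+b]^n-X^n : ∀ b n → PolyFun n (λ x → (x + b) ^ n - x ^ n)
  PolyFun-[X+b]^n-X^n b zero    x = -‿inverseʳ 1#
  PolyFun-[X+b]^n-X^n b (suc n) = PolyFun-resp (suc n)
    (λ x → solve 4 (λ x b y z → x :* (y :- z) :+ b :* y := (x :+ b) :* y :- x :* z) refl x b ((x + b) ^ n) (x ^ n))
    (PolyFun-+ (suc n) (PolyFun-X* n (PolyFun-[X+b]^n-X^n b n)) (PolyFun-* (suc n) b (PolyFun-[X+b]^ b n)))

  PolyFun-∑ : ∀ {i} {I : Set i} n (is : List I) {f : I → Carrier → Carrier} →
              (∀ i → PolyFun n (f i)) → PolyFun n (λ x → ∑ is (λ i → f i x))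
  PolyFun-∑ n []       pf = PolyFun-0 n
  PolyFun-∑ n (i ∷ is) pf = PolyFun-+ n (pf i) (PolyFun-∑ n is pf)

  -- Horner division by X - r: if h is the quotient for g, then g(r) + X h is the quotient for a + X
  -- g.
  PolyFun-factor : ∀ n {f} r → PolyFun (suc n) f →
                   ∃[ g ] PolyFun n g × (∀ x → f x ≈ f r + (x - r) * g x)
  PolyFun-factor zero {f} r (a , g , pg , f≈) = (λ _ → 0#) , (λ _ → refl) , λ x → begin
    f x                   ≈⟨ const x ⟩
    a                     ≈⟨ const r ⟨
    f r                   ≈⟨ +-identityʳ _ ⟨
    f r + 0#              ≈⟨ +-congˡ (zeroʳ _) ⟨
    f r + (x - r) * 0#    ∎
    where
    const : ∀ x → f x ≈ a
    const x = trans (f≈ x) (trans (+-congˡ (trans (*-congˡ (pg x)) (zeroʳ x))) (+-identityʳ a))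
  PolyFun-factor (suc n) {f} r (a , g , pg , f≈) with PolyFun-factor n r pg
  ... | h , ph , g≈ = _ , PolyFun-+ (suc n) (PolyFun-const n (g r)) (PolyFun-X* n ph) , λ x → begin
    f x                                            ≈⟨ f≈ x ⟩
    a + x * g x                                    ≈⟨ +-congˡ (*-congˡ (g≈ x)) ⟩
    a + x * (g r + (x - r) * h x)                  ≈⟨ solve 5 (λ a x r g h → a :+ x :* (g :+ (x :- r) :* h) := a :+ r :* g :+ (x :- r) :* (g :+ x :* h)) refl a x r (g r) (h x) ⟩
    a + r * g r + (x - r) * (g r + x * h x)        ≈⟨ +-congʳ (f≈ r) ⟨
    f r + (x - r) * (g r + x * h x)                ∎

  -- Splitting off X - r leaves a quotient vanishing at the remaining roots, since s - r is
  -- invertible for each of them.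
  PolyFun-roots⇒0 : ∀ {f} rs → Unique.Unique setoid rs → All (λ r → f r ≈ 0#) rs →
                    PolyFun (length rs) f → ∀ x → f x ≈ 0#
  PolyFun-roots⇒0 []       _ _ pf = pf
  PolyFun-roots⇒0 {f} (r ∷ rs) (r∉rs ∷ rs!) (fr≈0 ∷ frs≈0) pf x
    with PolyFun-factor (length rs) r pf
  ... | g , pg , f≈ = begin
    f x                  ≈⟨ factor x ⟩
    (x - r) * g x        ≈⟨ *-congˡ (PolyFun-roots⇒0 rs rs! (All.zipWith root (r∉rs , frs≈0)) pg x) ⟩
    (x - r) * 0#         ≈⟨ zeroʳ _ ⟩
    0#                   ∎
    where
    factor : ∀ x → f x ≈ (x - r) * g x
    factor x = trans (f≈ x) (trans (+-congʳ fr≈0) (+-identityˡ _))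
    root : ∀ {s} → (¬ r ≈ s) × f s ≈ 0# → g s ≈ 0#
    root (r≉s , fs≈0) = x≉0∧xy≈0⇒y≈0 (λ s-r≈0 → r≉s (sym (x-y≈0⇒x≈y _ _ s-r≈0))) (trans (sym (factor _)) fs≈0)

module _ {a ℓ} (S : Setoid a ℓ) where
  open Permutation S using (_↭_; ↭-trans; ↭-reflexive)
  open Permutationₚ S using (xs↭ys⇒|xs|≡|ys|)
  open Subset S using (_⊆_)
  open Unique S using (Unique)

  -- The pigeonhole principle: the part of `ys` left after removing `xs` has length zero.
  unique-⊆-length⇒↭ : ∀ {xs ys} → Unique xs → xs ⊆ ys → length xs ≡ length ys → ys ↭ xs
  unique-⊆-length⇒↭ {xs} {ys} xs! xs⊆ys |xs|≡|ys| with Sublist.unique-⊆⇒↭ S xs! xs⊆ys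
  ... | []     , ys↭ = ↭-trans ys↭ (↭-reflexive (List.++-identityʳ xs))
  ... | z ∷ zs , ys↭ = contradiction
    (≡.trans |xs|≡|ys| (≡.trans (xs↭ys⇒|xs|≡|ys| ys↭) (List.length-++ xs)))
    λ eq → ℕ.m≢1+m+n (length xs) (≡.trans eq (ℕ.+-suc (length xs) (length zs)))

-- Finite fields and the Frobenius of their extensions

module FiniteField {c ℓ} (F : Field c ℓ) {q : ℕ}
                   (card : Inverse (Field.setoid F) (≡.setoid (Fin q))) where
  open FieldProperties F
  open Inverse card using (to; from; to-cong; strictlyInverseˡ; strictlyInverseʳ)
  open Membership setoid using (_∈_)
  open Permutation setoid using (_↭_)
  open Permutationₚ setoid using (Unique-resp-↭; ∈-resp-↭)
  open Unique setoid using (Unique)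
  open import Relation.Binary.Reasoning.Setoid setoid

  _≈?_ : Decidable _≈_
  x ≈? y = map′ (λ eq → trans (sym (strictlyInverseʳ x)) (trans (reflexive (≡.cong from eq)) (strictlyInverseʳ y)))
                to-cong (to x Fin.≟ to y)

  elements : List Carrier
  elements = tabulate from

  |elements| : length elements ≡ q
  |elements| = List.length-tabulate from

  ∈-elements : ∀ x → x ∈ elements
  ∈-elements x = Membershipₚ.∈-resp-≈ setoid (strictlyInverseʳ x) (Membershipₚ.∈-tabulate⁺ setoid (to x))

  elements! : Unique elements
  elements! = Uniqueₚ.tabulate⁺ setoid λ {i} {j} eq →
    ≡.trans (≡.sym (strictlyInverseˡ i)) (≡.trans (to-cong eq) (strictlyInverseˡ j))

  private
    nontrivial-card : ∀ {n} (i j : Fin n) → ¬ i ≡ j → 2 ≤ n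
    nontrivial-card {1} Fin.zero Fin.zero i≢j = contradiction ≡.refl i≢j
    nontrivial-card {suc (suc _)} _ _ _ = s≤s (s≤s z≤n)

  2≤q : 2 ≤ q
  2≤q = nontrivial-card (to 1#) (to 0#) λ eq → 1≉0
    (trans (sym (strictlyInverseʳ 1#)) (trans (reflexive (≡.cong from eq)) (strictlyInverseʳ 0#)))

  -- A map with a section hits every element, and the image list has no room for repetitions.
  elements-↭ : ∀ {f g : Carrier → Carrier} → f Preserves _≈_ ⟶ _≈_ → (∀ x → f (g x) ≈ x) →
               map f elements ↭ elements
  elements-↭ {f} {g} f-cong fg≈id = unique-⊆-length⇒↭ setoid elements!
    (λ {x} _ → Membershipₚ.∈-resp-≈ setoid (fg≈id x)
      (Membershipₚ.∈-map⁺ setoid setoid f-cong (∈-elements (g x))))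
    (≡.sym (List.length-map f elements))

  nonzero-part : ∃[ xs ] elements ↭ 0# ∷ xs
  nonzero-part = Sublist.∈⇒↭ setoid (∈-elements 0#)

  units : List Carrier
  units = proj₁ nonzero-part

  elements↭0∷units : elements ↭ 0# ∷ units
  elements↭0∷units = proj₂ nonzero-part

  0∷units! : Unique (0# ∷ units)
  0∷units! = Unique-resp-↭ elements↭0∷units elements!

  units-nonzero : All (λ x → ¬ x ≈ 0#) units
  units-nonzero = All.map (λ 0≉x x≈0 → 0≉x (sym x≈0)) (Unique.head setoid 0∷units!)

  ∈-units : ∀ {x} → ¬ x ≈ 0# → x ∈ units
  ∈-units {x} x≉0 with ∈-resp-↭ elements↭0∷units (∈-elements x)
  ... | here x≈0      = contradiction x≈0 x≉0
  ... | there x∈units = x∈units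

  units-scale-↭ : ∀ {x} → ¬ x ≈ 0# → map (x *_) units ↭ units
  units-scale-↭ {x} x≉0 = unique-⊆-length⇒↭ setoid (Unique.tail setoid 0∷units!)
    (λ {y} y∈units → Membershipₚ.∈-resp-≈ setoid (x[x⁻¹y]≈y y)
      (Membershipₚ.∈-map⁺ setoid setoid *-congˡ
        (∈-units (*-nonzero (⁻¹-nonzero x≉0) (nonzero y∈units)))))
    (≡.sym (List.length-map (x *_) units))
    where
    x[x⁻¹y]≈y : ∀ y → x * (x ⁻¹ * y) ≈ y
    x[x⁻¹y]≈y y = trans (sym (*-assoc _ _ _)) (trans (*-congʳ (inverseʳ x≉0)) (*-identityˡ y))
    nonzero : ∀ {y} → y ∈ units → ¬ y ≈ 0#
    nonzero = All.lookupₛ setoid (λ y≈z y≉0 z≈0 → y≉0 (trans y≈z z≈0)) units-nonzero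

  -- Lagrange's argument: multiplication by x permutes the units, so their product absorbs one
  -- factor x per unit. Writing the power as a constant product avoids computing the length of
  -- `units`.
  ∏-units-const≈1 : ∀ {x} → ¬ x ≈ 0# → ∏ units (λ _ → x) ≈ 1#
  ∏-units-const≈1 {x} x≉0 = *-cancelˡ-nonzero (∏-nonzero units-nonzero) (begin
    ∏ units (λ y → y) * ∏ units (λ _ → x)  ≈⟨ *-comm _ _ ⟩
    ∏ units (λ _ → x) * ∏ units (λ y → y)  ≈⟨ ∏-* units _ _ ⟨
    ∏ units (λ y → x * y)                  ≈⟨ ∏-map (x *_) units (λ y → y) ⟨
    ∏ (map (x *_) units) (λ y → y)         ≈⟨ ∏-↭ setoid (λ eq → eq) (units-scale-↭ x≉0) ⟩
    ∏ units (λ y → y)                      ≈⟨ *-identityʳ _ ⟨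
    ∏ units (λ y → y) * 1#                 ∎)

  x^q≈x∏units : ∀ x → x ^ q ≈ x * ∏ units (λ _ → x)
  x^q≈x∏units x = begin
    x ^ q                                      ≡⟨ ≡.cong (x ^_) |elements| ⟨
    x ^ length elements                        ≈⟨ ∏-const elements x ⟨
    ∏ elements (λ _ → x)                       ≈⟨ ∏-↭ setoid (λ _ → refl) elements↭0∷units ⟩
    x * ∏ units (λ _ → x)                      ∎

  fermat : ∀ x → x ^ q ≈ x
  fermat x with x ≈? 0#
  ... | yes x≈0 = trans (x^q≈x∏units x) (trans (*-congʳ x≈0) (trans (zeroˡ _) (sym x≈0)))
  ... | no  x≉0 = trans (x^q≈x∏units x) (trans (*-congˡ (∏-units-const≈1 x≉0)) (*-identityʳ x))

  ∑-shift : ∀ b {f : Carrier → Carrier} → f Preserves _≈_ ⟶ _≈_ →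
            ∑ elements (λ x → f (b + x)) ≈ ∑ elements f
  ∑-shift b {f} f-cong = trans (sym (∑-map (b +_) elements f)) (∑-↭ setoid f-cong
    (elements-↭ {g = λ x → - b + x} +-congˡ
      (λ x → solve 2 (λ b x → b :+ (:- b :+ x) := x) refl b x)))

  -- This is q = 0 in the field: the translation x ↦ 1 + x permutes the elements, so ∑ x = ∑ 1 + ∑
  -- x.
  ∑1≈0 : ∑ elements (λ _ → 1#) ≈ 0#
  ∑1≈0 = +-cancelʳ (∑ elements (λ x → x)) _ _ (begin
    ∑ elements (λ _ → 1#) + ∑ elements (λ x → x)  ≈⟨ ∑-+ elements _ _ ⟨
    ∑ elements (λ x → 1# + x)                     ≈⟨ ∑-shift 1# (λ eq → eq) ⟩
    ∑ elements (λ x → x)                          ≈⟨ +-identityˡ _ ⟨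
    0# + ∑ elements (λ x → x)                     ∎)

  ∑x^[q-1]≈-1 : ∀ n → suc n ≡ q → ∑ elements (_^ n) ≈ - 1#
  ∑x^[q-1]≈-1 zero    ≡.refl = contradiction 2≤q λ { (s≤s ()) }
  ∑x^[q-1]≈-1 (suc n) ≡.refl = begin
    ∑ elements (_^ suc n)                  ≈⟨ ∑-↭ setoid (^-congˡ (suc n)) elements↭0∷units ⟩
    0# * 0# ^ n + ∑ units (_^ suc n)       ≈⟨ +-cong (zeroˡ _) (∑units units-nonzero) ⟩
    -- The units alone give ∑ 1 minus the contribution of the zero element.
    0# + ∑ units (λ _ → 1#)                ≈⟨ solve 1 (λ x → con ℤ.0ℤ :+ x := (con 1ℤ :+ x) :- con 1ℤ) refl _ ⟩
    (1# + ∑ units (λ _ → 1#)) - 1#         ≈⟨ +-congʳ (∑-↭ setoid (λ _ → refl) elements↭0∷units) ⟨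
    ∑ elements (λ _ → 1#) - 1#             ≈⟨ +-congʳ ∑1≈0 ⟩
    0# - 1#                                ≈⟨ +-identityˡ _ ⟩
    - 1#                                   ∎
    where
    ∑units : ∀ {xs} → All (λ x → ¬ x ≈ 0#) xs → ∑ xs (_^ suc n) ≈ ∑ xs (λ _ → 1#)
    ∑units []           = refl
    ∑units (x≉0 ∷ xs≉0) = +-cong (x≉0∧x^[1+n]≈x⇒x^n≈1 (suc n) x≉0 (fermat _)) (∑units xs≉0)

module FiniteFieldExtension {c ℓ} (F : Field c ℓ) {q : ℕ}
                            (card : Inverse (Field.setoid F) (≡.setoid (Fin q)))
                            (E : Field c ℓ) (ι : Field.Carrier F → Field.Carrier E)
                            (ι-hom : IsFieldHom F E ι) where
  private
    module F = FieldProperties F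
  open FiniteField F card using (elements; elements!; |elements|; 2≤q; fermat; ∑-shift; ∑1≈0; ∑x^[q-1]≈-1; _≈?_)
  open FieldProperties E
  open IsRingHomomorphism ι-hom renaming (⟦⟧-cong to ι-cong; +-homo to ι-+; *-homo to ι-*; -‿homo to ι-neg; 0#-homo to ι-0; 1#-homo to ι-1)
  open import Relation.Binary.Reasoning.Setoid setoid

  ι-nonzero : ∀ {a} → ¬ a F.≈ F.0# → ¬ ι a ≈ 0#
  ι-nonzero {a} a≉0 = xy≈1⇒x≉0 (trans (sym (ι-* a (a F.⁻¹))) (trans (ι-cong (F.inverseʳ a≉0)) ι-1))

  ι-^ : ∀ a n → ι (a F.^ n) ≈ ι a ^ n
  ι-^ a zero    = ι-1
  ι-^ a (suc n) = trans (ι-* a _) (*-congˡ (ι-^ a n))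

  ι-∑ : ∀ {i} {I : Set i} (is : List I) f → ι (F.∑ is f) ≈ ∑ is (λ i → ι (f i))
  ι-∑ []       f = ι-0
  ι-∑ (i ∷ is) f = trans (ι-+ _ _) (+-congˡ (ι-∑ is f))

  ι-fermat : ∀ a → ι a ^ q ≈ ι a
  ι-fermat a = trans (sym (ι-^ a q)) (ι-cong (fermat a))

  0^q≈0 : 0# ^ q ≈ 0#
  0^q≈0 = trans (^-congˡ q (sym ι-0)) (trans (ι-fermat F.0#) ι-0)

  suc-pred-q : suc (ℕ.pred q) ≡ q
  suc-pred-q = ℕ.suc-pred q {{ℕ.>-nonZero (ℕ.≤-trans (s≤s z≤n) 2≤q)}}

  roots : List Carrier
  roots = map ι elements

  roots! : Unique.Unique setoid roots
  roots! = Uniqueₚ.map⁺ F.setoid setoid injective elements!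
    where
    injective : ∀ {a b} → ι a ≈ ι b → a F.≈ b
    injective {a} {b} ιa≈ιb with a ≈? b
    ... | yes a≈b = a≈b
    ... | no  a≉b = contradiction
      (trans (ι-+ a (F.- b)) (trans (+-congˡ (ι-neg b)) (x≈y⇒x-y≈0 ιa≈ιb)))
      (ι-nonzero (λ a-b≈0 → a≉b (F.x-y≈0⇒x≈y a b a-b≈0)))

  -- Identities of degree below q over E thereby reduce to points of 𝔽_q, where `fermat` is
  -- available.
  PolyFun-q⇒0 : ∀ {f} → PolyFun q f → (∀ a → f (ι a) ≈ 0#) → ∀ x → f x ≈ 0#
  PolyFun-q⇒0 {f} pf f∘ι≈0 = PolyFun-roots⇒0 roots roots! (All.map⁺ (All.universal f∘ι≈0 elements))
    (≡.subst (λ n → PolyFun n f) (≡.sym (≡.trans (List.length-map ι elements) |elements|)) pf)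

  PolyFun-q-const : ∀ b → PolyFun q (λ _ → b)
  PolyFun-q-const b = ≡.subst (λ n → PolyFun n (λ _ → b)) suc-pred-q (PolyFun-const (ℕ.pred q) b)

  -- The difference of the two sides has degree below q in x, and on 𝔽_q it vanishes by `fermat`.
  frobenius-+ι : ∀ x a → (x + ι a) ^ q ≈ x ^ q + ι a
  frobenius-+ι x a = x-y≈0⇒x≈y _ _ (trans
    (solve 3 (λ u v w → u :- (v :+ w) := u :- v :+ (:- w)) refl _ _ _) (zero-fun x))
    where
    zero-fun : ∀ x → ((x + ι a) ^ q - x ^ q) + - ι a ≈ 0#
    zero-fun = PolyFun-q⇒0 (PolyFun-+ q (PolyFun-[X+b]^n-X^n (ι a) q) (PolyFun-q-const (- ι a))) λ b → begin
      ((ι b + ι a) ^ q - ι b ^ q) + - ι a     ≈⟨ +-congʳ (+-cong (^-congˡ q (ι-+ b a)) (-‿cong (sym (ι-fermat b)))) ⟨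
      (ι (b F.+ a) ^ q - ι b) + - ι a         ≈⟨ +-congʳ (+-congʳ (trans (ι-fermat _) (ι-+ b a))) ⟩
      (ι b + ι a - ι b) + - ι a               ≈⟨ solve 2 (λ a b → (b :+ a :- b) :+ (:- a) := con ℤ.0ℤ) refl (ι a) (ι b) ⟩
      0#                                      ∎

  -- For fixed y both sides are polynomials in x agreeing on 𝔽_q, and their
  -- difference has degree < q; for y in 𝔽_q this is the previous lemma.
  frobenius-+ : ∀ x y → (x + y) ^ q ≈ x ^ q + y ^ q
  frobenius-+ x y = x-y≈0⇒x≈y _ _ (trans
    (solve 3 (λ u v w → u :- (v :+ w) := u :- v :+ (:- w)) refl _ _ _) (zero-fun x))
    where
    zero-fun : ∀ x → ((x + y) ^ q - x ^ q) + - (y ^ q) ≈ 0#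
    zero-fun = PolyFun-q⇒0 (PolyFun-+ q (PolyFun-[X+b]^n-X^n y q) (PolyFun-q-const (- (y ^ q)))) λ b → begin
      ((ι b + y) ^ q - ι b ^ q) + - (y ^ q)   ≈⟨ +-congʳ (+-cong (trans (^-congˡ q (+-comm (ι b) y)) (frobenius-+ι y b)) (-‿cong (ι-fermat b))) ⟩
      (y ^ q + ι b - ι b) + - (y ^ q)         ≈⟨ solve 2 (λ a b → (a :+ b :- b) :+ (:- a) := con ℤ.0ℤ) refl (y ^ q) (ι b) ⟩
      0#                                      ∎

  frobenius-neg : ∀ x → (- x) ^ q ≈ - (x ^ q)
  frobenius-neg x = +-cancelʳ (x ^ q) _ _ (begin
    (- x) ^ q + x ^ q    ≈⟨ frobenius-+ (- x) x ⟨
    (- x + x) ^ q        ≈⟨ ^-congˡ q (-‿inverseˡ x) ⟩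
    0# ^ q               ≈⟨ 0^q≈0 ⟩
    0#                   ≈⟨ -‿inverseˡ _ ⟨
    - (x ^ q) + x ^ q    ∎)

  frobenius-- : ∀ x y → (x - y) ^ q ≈ x ^ q - y ^ q
  frobenius-- x y = trans (frobenius-+ x (- y)) (+-congˡ (frobenius-neg y))

  ∑ι≈0 : ∀ x → ∑ elements (λ _ → x) ≈ 0#
  ∑ι≈0 x = begin
    ∑ elements (λ _ → x)          ≈⟨ ∑-cong elements (λ _ → trans (*-congˡ ι-1) (*-identityʳ x)) ⟨
    ∑ elements (λ _ → x * ι F.1#) ≈⟨ ∑-*ˡ elements x _ ⟩
    x * ∑ elements (λ _ → ι F.1#) ≈⟨ *-congˡ (ι-∑ elements _) ⟨
    x * ι (F.∑ elements (λ _ → F.1#)) ≈⟨ *-congˡ (trans (ι-cong ∑1≈0) ι-0) ⟩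
    x * 0#                        ≈⟨ zeroʳ x ⟩
    0#                            ∎

  -- The sum has degree at most q - 1 in x; at x = b in 𝔽_q, translation by b turns it into the
  -- power sum over 𝔽_q.
  ∑[x+ι]^[q-1]≈-1 : ∀ n → suc n ≡ q → ∀ x → ∑ elements (λ a → (x + ι a) ^ n) ≈ - 1#
  ∑[x+ι]^[q-1]≈-1 n ≡.refl x = x-y≈0⇒x≈y _ _ (trans (+-congˡ (-‿involutive 1#)) (zero-fun x))
    where
    zero-fun : ∀ x → ∑ elements (λ a → (x + ι a) ^ n) + 1# ≈ 0#
    zero-fun = PolyFun-q⇒0 (PolyFun-+ q (PolyFun-∑ q elements (λ a → PolyFun-[X+b]^ (ι a) n)) (PolyFun-const n 1#)) λ b → begin
      ∑ elements (λ a → (ι b + ι a) ^ n) + 1#       ≈⟨ +-congʳ (∑-cong elements (λ a → trans (ι-^ _ n) (^-congˡ n (ι-+ b a)))) ⟨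
      ∑ elements (λ a → ι ((b F.+ a) F.^ n)) + 1#   ≈⟨ +-congʳ (ι-∑ elements _) ⟨
      ι (F.∑ elements (λ a → (b F.+ a) F.^ n)) + 1# ≈⟨ +-congʳ (ι-cong (F.trans (∑-shift b (F.^-congˡ n)) (∑x^[q-1]≈-1 n ≡.refl))) ⟩
      ι (F.- F.1#) + 1#                             ≈⟨ +-congʳ (trans (ι-neg F.1#) (-‿cong ι-1)) ⟩
      - 1# + 1#                                     ≈⟨ -‿inverseˡ 1# ⟩
      0#                                            ∎

  -- For every a in 𝔽_q, x^q - x = (x + a)^q - (x + a), so each summand becomes (x + a)^(q-1) - 1;
  -- the constants add up to -q = 0.
  artin-schreier-sum : ∀ {x} → (∀ a → ¬ x + ι a ≈ 0#) →
                       (x ^ q - x) * ∑ elements (λ a → (x + ι a) ⁻¹) ≈ - 1#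
  artin-schreier-sum {x} x+a≉0 = begin
    (x ^ q - x) * ∑ elements (λ a → (x + ι a) ⁻¹)              ≈⟨ ∑-*ˡ elements _ _ ⟨
    ∑ elements (λ a → (x ^ q - x) * (x + ι a) ⁻¹)              ≈⟨ ∑-cong elements term ⟩
    ∑ elements (λ a → (x + ι a) ^ n + - 1#)                    ≈⟨ ∑-+ elements _ _ ⟩
    ∑ elements (λ a → (x + ι a) ^ n) + ∑ elements (λ _ → - 1#) ≈⟨ +-cong (∑[x+ι]^[q-1]≈-1 n suc-pred-q x) (∑ι≈0 (- 1#)) ⟩
    - 1# + 0#                                                  ≈⟨ +-identityʳ _ ⟩
    - 1#                                                       ∎
    where
    n = ℕ.pred q
    term : ∀ a → (x ^ q - x) * (x + ι a) ⁻¹ ≈ (x + ι a) ^ n + - 1#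
    term a = begin
      (x ^ q - x) * (x + ι a) ⁻¹                        ≈⟨ *-congʳ (solve 3 (λ u x a → u :- x := u :+ a :- (x :+ a)) refl _ x (ι a)) ⟩
      (x ^ q + ι a - (x + ι a)) * (x + ι a) ⁻¹          ≈⟨ *-congʳ (+-congʳ (frobenius-+ι x a)) ⟨
      ((x + ι a) ^ q - (x + ι a)) * (x + ι a) ⁻¹        ≡⟨ ≡.cong (λ m → ((x + ι a) ^ m - (x + ι a)) * (x + ι a) ⁻¹) suc-pred-q ⟨
      ((x + ι a) ^ suc n - (x + ι a)) * (x + ι a) ⁻¹    ≈⟨ solve 3 (λ z w u → (z :* u :- z) :* w := (u :- con 1ℤ) :* (z :* w)) refl (x + ι a) ((x + ι a) ⁻¹) ((x + ι a) ^ n) ⟩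
      ((x + ι a) ^ n - 1#) * ((x + ι a) * (x + ι a) ⁻¹) ≈⟨ *-congˡ (inverseʳ (x+a≉0 a)) ⟩
      ((x + ι a) ^ n - 1#) * 1#                         ≈⟨ *-identityʳ _ ⟩
      (x + ι a) ^ n - 1#                                ∎

  -- A zero factor would turn `artin-schreier-sum` into 0 = -1.
  artin-schreier-nonzero : ∀ {x} → (∀ a → ¬ x + ι a ≈ 0#) → ¬ x ^ q - x ≈ 0#
  artin-schreier-nonzero x+a≉0 x^q-x≈0 = 1≉0 (begin
    1#      ≈⟨ -‿involutive 1# ⟨
    - - 1#  ≈⟨ -‿cong (trans (sym (artin-schreier-sum x+a≉0)) (trans (*-congʳ x^q-x≈0) (zeroˡ _))) ⟩
    - 0#    ≈⟨ -0#≈0# ⟩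
    0#      ∎)

-- Power sums over monic polynomials

module Words {c ℓ} (F : Field c ℓ) {q : ℕ}
             (card : Inverse (Field.setoid F) (≡.setoid (Fin q))) where
  open Field F using (Carrier; setoid)
  open FiniteField F card using (elements; elements!; ∈-elements)

  private
    S = MonicPolySetoid F

  open Setoid S using (_≈_)
  open Membership S using (_∈_)
  open Unique S using (Unique)

  -- In the `MonicPoly` encoding a word of length k is a monic polynomial of degree k; read as a
  -- `Poly` it is any polynomial of degree below k.
  words : ℕ → List (List Carrier)
  words zero    = [] ∷ []
  words (suc k) = cartesianProductWith _∷_ elements (words k)

  words≤ : ℕ → List (List Carrier)
  words≤ zero    = words 0
  words≤ (suc n) = words≤ n ++ words (suc n)

  words-length : ∀ k → All (λ as → length as ≡ k) (words k)
  words-length zero    = ≡.refl ∷ []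
  words-length (suc k) = All.cartesianProductWith⁺ (≡.setoid _) (≡.setoid _) _∷_ elements (words k)
    (λ _ as∈words → ≡.cong suc (All.lookup (words-length k) as∈words))

  words! : ∀ k → Unique (words k)
  words! zero    = [] AllPairs.∷ AllPairs.[]
  words! (suc k) = Uniqueₚ.cartesianProductWith⁺ setoid S S _∷_
    (λ { (a≈b ∷ as≈bs) → a≈b , as≈bs }) elements! (words! k)

  ∈-words : ∀ as → as ∈ words (length as)
  ∈-words []       = Any.here []
  ∈-words (a ∷ as) = Membershipₚ.∈-cartesianProductWith⁺ setoid S S _∷_ (∈-elements a) (∈-words as)

  ∈-words⇒length : ∀ k {as} → as ∈ words k → length as ≡ k
  ∈-words⇒length k = All.lookupₛ S
    (λ as≈bs |as|≡k → ≡.trans (≡.sym (Pointwise.Pointwise-length as≈bs)) |as|≡k) (words-length k)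

  ∈-words≤⇒length : ∀ n {as} → as ∈ words≤ n → length as ℕ.≤ n
  ∈-words≤⇒length zero    as∈ = ℕ.≤-reflexive (∈-words⇒length 0 as∈)
  ∈-words≤⇒length (suc n) as∈ with Membershipₚ.∈-++⁻ S (words≤ n) as∈
  ... | inj₁ as∈′ = ℕ.m≤n⇒m≤1+n (∈-words≤⇒length n as∈′)
  ... | inj₂ as∈′ = ℕ.≤-reflexive (∈-words⇒length (suc n) as∈′)

  ∈-words≤ : ∀ n as → length as ℕ.≤ n → as ∈ words≤ n
  ∈-words≤ zero    [] _ = Any.here []
  ∈-words≤ (suc n) as |as|≤1+n with ℕ.m≤n⇒m<n∨m≡n |as|≤1+n
  ... | inj₁ (s≤s |as|≤n) = Membershipₚ.∈-++⁺ˡ S (∈-words≤ n as |as|≤n)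
  ... | inj₂ |as|≡1+n     = Membershipₚ.∈-++⁺ʳ S (words≤ n)
    (≡.subst (λ k → as ∈ words k) |as|≡1+n (∈-words as))

  words≤! : ∀ n → Unique (words≤ n)
  words≤! zero    = words! 0
  words≤! (suc n) = Uniqueₚ.++⁺ S (words≤! n) (words! (suc n)) λ (as∈ , as∈′) →
    ℕ.<-irrefl (∈-words⇒length (suc n) as∈′) (s≤s (∈-words≤⇒length n as∈))

module _ {c ℓ} (E : Field c ℓ) where
  open Field E

  -- The `suc` excludes the trivial period 0. Refuting this for θ makes all Carlitz brackets of
  -- positive index nonzero.
  FrobeniusPeriodic : ℕ → Carrier → Set ℓ
  FrobeniusPeriodic q x = ∃[ k ] x ^ (q ℕ.^ suc k) ≈ x

module CarlitzSums {c ℓ} (F : Field c ℓ) {q : ℕ}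
                   (card : Inverse (Field.setoid F) (≡.setoid (Fin q)))
                   (E : Field c ℓ) (ι : Field.Carrier F → Field.Carrier E)
                   (ι-hom : IsFieldHom F E ι)
                   (θ t : Field.Carrier E)
                   (θ-aperiodic : ¬ FrobeniusPeriodic E q θ)
                   (θ-transcendental : ¬ IsAlgebraic F E ι θ)
                   where
  private
    module F = FieldProperties F
  open FiniteField F card using (elements)
  open Words F card using (words; words≤; words-length)
  open FiniteFieldExtension F card E ι ι-hom
  open FieldProperties E
  open IsRingHomomorphism ι-hom using ()
    renaming (1#-homo to ι-1)
  open import Relation.Binary.Reasoning.Setoid setoid

  ⟪_⟫ : List F.Carrier → Carrier → Carrier
  ⟪ as ⟫ x = eval F E ι as x

  -- `words` grows at the constant term, whereas the induction on the degree peels off the top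
  -- coefficient; exchanging the two sums passes from one to the other.
  ∑-words-∷ʳ : ∀ k f → ∑ (words (suc k)) f ≈ ∑ elements (λ a → ∑ (words k) (λ as → f (as ∷ʳ a)))
  ∑-words-∷ʳ zero    f = ∑-cartesianProductWith _∷_ elements (words 0) f
  ∑-words-∷ʳ (suc k) f = begin
    ∑ (words (suc (suc k))) f
      ≈⟨ ∑-cartesianProductWith _∷_ elements (words (suc k)) f ⟩
    ∑ elements (λ a → ∑ (words (suc k)) (λ as → f (a ∷ as)))
      ≈⟨ ∑-cong elements (λ a → ∑-words-∷ʳ k (λ as → f (a ∷ as))) ⟩
    ∑ elements (λ a → ∑ elements (λ b → ∑ (words k) (λ as → f (a ∷ as ∷ʳ b))))
      ≈⟨ ∑-swap elements elements _ ⟩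
    ∑ elements (λ b → ∑ elements (λ a → ∑ (words k) (λ as → f (a ∷ as ∷ʳ b))))
      ≈⟨ ∑-cong elements (λ b → ∑-cartesianProductWith _∷_ elements (words k) (λ as → f (as ∷ʳ b))) ⟨
    ∑ elements (λ b → ∑ (words (suc k)) (λ as → f (as ∷ʳ b)))
      ∎

  eval-∷ʳ : ∀ as a x → ⟪ as ∷ʳ a ⟫ x ≈ ι a * x ^ length as + ⟪ as ⟫ x
  eval-∷ʳ []       a x = solve 2 (λ u x → u :+ x :* con 0ℤ := u :* con 1ℤ :+ con 0ℤ) refl (ι a) x
  eval-∷ʳ (b ∷ as) a x = trans (+-congˡ (*-congˡ (eval-∷ʳ as a x)))
    (solve 5 (λ b x a p e → b :+ x :* (a :* p :+ e) := a :* (x :* p) :+ (b :+ x :* e)) refl _ x (ι a) _ _)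

  θ[_] : ℕ → Carrier
  θ[ k ] = θ ^ (q ℕ.^ k)

  θ[0]≈θ : θ[ 0 ] ≈ θ
  θ[0]≈θ = *-identityʳ θ

  θ[]^q : ∀ k → θ[ k ] ^ q ≈ θ[ suc k ]
  θ[]^q k = trans (^-assocʳ θ (q ℕ.^ k) q) (^-congʳ θ (ℕ.*-comm (q ℕ.^ k) q))

  θ^q≈θ[1] : θ ^ q ≈ θ[ 1 ]
  θ^q≈θ[1] = ^-congʳ θ (≡.sym (ℕ.*-identityʳ q))

  -- Carlitz's [k+1], indexed so that the vanishing [0] never occurs as a denominator.
  [_+1] : ℕ → Carrier
  [ k +1] = θ[ suc k ] - θ

  -- For z = a(θ), w = a(t): x k z is the divided difference of a at the nodes
  -- θ, θ^q, …, θ^(q^k), and y k z w is the error at t of the Newton interpolation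
  -- of a at the first k of these nodes.
  x : ℕ → Carrier → Carrier
  x zero    z = z
  x (suc k) z = (x k z ^ q - x k z) * [ k +1] ⁻¹

  b : ℕ → Carrier
  b zero    = 1#
  b (suc k) = b k * (t - θ[ k ])

  y : ℕ → Carrier → Carrier → Carrier
  y zero    z w = w
  y (suc k) z w = y k z w - b k * x k z

  x-linear : ∀ k a z z′ → x k (ι a * z + z′) ≈ ι a * x k z + x k z′
  x-linear zero    a z z′ = refl
  x-linear (suc k) a z z′ = begin
    (x k (ι a * z + z′) ^ q - x k (ι a * z + z′)) * [ k +1] ⁻¹
      ≈⟨ *-congʳ (+-cong (^-congˡ q (x-linear k a z z′)) (-‿cong (x-linear k a z z′))) ⟩
    ((ι a * x k z + x k z′) ^ q - (ι a * x k z + x k z′)) * [ k +1] ⁻¹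
      ≈⟨ *-congʳ (+-congʳ (frobenius-+ _ _)) ⟩
    ((ι a * x k z) ^ q + x k z′ ^ q - (ι a * x k z + x k z′)) * [ k +1] ⁻¹
      ≈⟨ *-congʳ (+-congʳ (+-congʳ (trans (^-distrib-* _ _ q) (*-congʳ (ι-fermat a))))) ⟩
    (ι a * x k z ^ q + x k z′ ^ q - (ι a * x k z + x k z′)) * [ k +1] ⁻¹
      ≈⟨ solve 6 (λ a z zq z′ zq′ i → (a :* zq :+ zq′ :- (a :* z :+ z′)) :* i := a :* ((zq :- z) :* i) :+ (zq′ :- z′) :* i) refl (ι a) (x k z) _ (x k z′) _ _ ⟩
    ι a * x (suc k) z + x (suc k) z′ ∎

  y-linear : ∀ k a z z′ w w′ → y k (ι a * z + z′) (ι a * w + w′) ≈ ι a * y k z w + y k z′ w′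
  y-linear zero    a z z′ w w′ = refl
  y-linear (suc k) a z z′ w w′ = trans
    (+-cong (y-linear k a z z′ w w′) (-‿cong (*-congˡ (x-linear k a z z′))))
    (solve 6 (λ a y y′ b x x′ → a :* y :+ y′ :- b :* (a :* x :+ x′) := a :* (y :- b :* x) :+ (y′ :- b :* x′)) refl (ι a) (y k z w) (y k z′ w′) (b k) (x k z) (x k z′))

  [+1]-nonzero : ∀ k → ¬ [ k +1] ≈ 0#
  [+1]-nonzero k eq = θ-aperiodic (k , x-y≈0⇒x≈y _ _ eq)

  [+1]*x : ∀ k z → [ k +1] * x (suc k) z ≈ x k z ^ q - x k z
  [+1]*x k z = trans (solve 3 (λ b d i → b :* (d :* i) := d :* (b :* i)) refl _ _ _)
    (trans (*-congˡ (inverseʳ ([+1]-nonzero k))) (*-identityʳ _))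

  -- Leibniz rule for divided differences: Xa = θ_(k+1) a + (X - θ_(k+1)) a, and the second summand
  -- has over the nodes θ_0, ..., θ_(k+1) the divided difference of a over θ_0, ..., θ_k.
  x-θ* : ∀ k z → x (suc k) (θ * z) ≈ θ[ suc k ] * x (suc k) z + x k z
  -- The rule before division by [k+1]. In its inductive step the cross terms combine to [k+1] times
  -- `x (suc k) z`, which replaces θ_(k+1) by θ in the last term.
  x-θ*-numerator : ∀ k z → x k (θ * z) ^ q - x k (θ * z) ≈ θ[ suc k ] * x k z ^ q - θ * x k z

  x-θ* k z = begin
    (x k (θ * z) ^ q - x k (θ * z)) * [ k +1] ⁻¹
      ≈⟨ *-congʳ (x-θ*-numerator k z) ⟩
    (θ[ suc k ] * x k z ^ q - θ * x k z) * [ k +1] ⁻¹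
      ≈⟨ solve 5 (λ n xq θ x i → (n :* xq :- θ :* x) :* i := n :* ((xq :- x) :* i) :+ x :* ((n :- θ) :* i)) refl θ[ suc k ] (x k z ^ q) θ (x k z) _ ⟩
    θ[ suc k ] * x (suc k) z + x k z * ([ k +1] * [ k +1] ⁻¹)
      ≈⟨ +-congˡ (trans (*-congˡ (inverseʳ ([+1]-nonzero k))) (*-identityʳ _)) ⟩
    θ[ suc k ] * x (suc k) z + x k z ∎

  x-θ*-numerator zero    z = +-congʳ (trans (^-distrib-* θ z q) (*-congʳ θ^q≈θ[1]))
  x-θ*-numerator (suc k) z = begin
    x (suc k) (θ * z) ^ q - x (suc k) (θ * z)
      ≈⟨ +-cong (^-congˡ q (x-θ* k z)) (-‿cong (x-θ* k z)) ⟩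
    (θ[ suc k ] * x (suc k) z + x k z) ^ q - (θ[ suc k ] * x (suc k) z + x k z)
      ≈⟨ +-congʳ (trans (frobenius-+ _ _) (+-congʳ (trans (^-distrib-* _ _ q) (*-congʳ (θ[]^q (suc k)))))) ⟩
    θ[ suc (suc k) ] * x (suc k) z ^ q + x k z ^ q - (θ[ suc k ] * x (suc k) z + x k z)
      ≈⟨ solve 4 (λ u v w x → u :+ v :- (w :+ x) := u :+ (v :- x) :- w) refl _ _ _ _ ⟩
    θ[ suc (suc k) ] * x (suc k) z ^ q + (x k z ^ q - x k z) - θ[ suc k ] * x (suc k) z
      ≈⟨ +-congʳ (+-congˡ ([+1]*x k z)) ⟨
    θ[ suc (suc k) ] * x (suc k) z ^ q + [ k +1] * x (suc k) z - θ[ suc k ] * x (suc k) z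
      ≈⟨ solve 4 (λ u n θ x → u :+ (n :- θ) :* x :- n :* x := u :- θ :* x) refl _ θ[ suc k ] θ (x (suc k) z) ⟩
    θ[ suc (suc k) ] * x (suc k) z ^ q - θ * x (suc k) z ∎

  -- Again Xa = θ_k a + (X - θ_k) a: the interpolant of (X - θ_k) a at θ_0, ..., θ_k is X - θ_k
  -- times that of a at the first k nodes.
  y-θ* : ∀ k z w → y (suc k) (θ * z) (t * w) ≈ θ[ k ] * y (suc k) z w + (t - θ[ k ]) * y k z w
  y-θ* zero    z w = trans
    (solve 4 (λ t w θ z → t :* w :- con 1ℤ :* (θ :* z) := θ :* (w :- con 1ℤ :* z) :+ (t :- θ) :* w) refl t w θ z)
    (sym (+-cong (*-congʳ θ[0]≈θ) (*-congʳ (+-congˡ (-‿cong θ[0]≈θ)))))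
  y-θ* (suc k) z w = trans
    (+-cong (y-θ* k z w) (-‿cong (*-congˡ (x-θ* k z))))
    (solve 7 (λ n m t b y x x′ →
      n :* (y :- b :* x) :+ (t :- n) :* y :- b :* (t :- n) :* (m :* x′ :+ x) :=
      m :* (y :- b :* x :- b :* (t :- n) :* x′) :+ (t :- m) :* (y :- b :* x)) refl
      θ[ k ] θ[ suc k ] t (b k) (y k z w) (x k z) (x (suc k) z))

  -- A divided difference over k + 1 nodes reads off the coefficient of X^k in degree at most k; one
  -- further node gives 0. Each of the two statements feeds the induction of the other.
  x-θ^ : ∀ k → x k (θ ^ k) ≈ 1#
  x-θ^-above : ∀ k → x (suc k) (θ ^ k) ≈ 0#

  x-θ^ zero    = refl
  x-θ^ (suc k) = begin
    x (suc k) (θ * θ ^ k)                             ≈⟨ x-θ* k (θ ^ k) ⟩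
    θ[ suc k ] * x (suc k) (θ ^ k) + x k (θ ^ k)      ≈⟨ +-cong (*-congˡ (x-θ^-above k)) (x-θ^ k) ⟩
    θ[ suc k ] * 0# + 1#                              ≈⟨ solve 1 (λ n → n :* con 0ℤ :+ con 1ℤ := con 1ℤ) refl _ ⟩
    1#                                                ∎

  x-θ^-above k = begin
    (x k (θ ^ k) ^ q - x k (θ ^ k)) * [ k +1] ⁻¹
      ≈⟨ *-congʳ (+-cong (trans (^-congˡ q (x-θ^ k)) (1^n≈1 q)) (-‿cong (x-θ^ k))) ⟩
    (1# - 1#) * [ k +1] ⁻¹
      ≈⟨ *-congʳ (-‿inverseʳ 1#) ⟩
    0# * [ k +1] ⁻¹
      ≈⟨ zeroˡ _ ⟩
    0# ∎

  -- X^k minus its interpolant at k nodes is monic of degree k and vanishes at these nodes, hence is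
  -- the nodal polynomial.
  y-θ^ : ∀ k → y k (θ ^ k) (t ^ k) ≈ b k
  y-θ^ zero    = refl
  y-θ^ (suc k) = begin
    y (suc k) (θ * θ ^ k) (t * t ^ k)
      ≈⟨ y-θ* k (θ ^ k) (t ^ k) ⟩
    θ[ k ] * (y k (θ ^ k) (t ^ k) - b k * x k (θ ^ k)) + (t - θ[ k ]) * y k (θ ^ k) (t ^ k)
      ≈⟨ +-cong (*-congˡ (+-cong (y-θ^ k) (-‿cong (*-congˡ (x-θ^ k))))) (*-congˡ (y-θ^ k)) ⟩
    θ[ k ] * (b k - b k * 1#) + (t - θ[ k ]) * b k
      ≈⟨ solve 3 (λ n t b → n :* (b :- b :* con 1ℤ) :+ (t :- n) :* b := b :* (t :- n)) refl θ[ k ] t (b k) ⟩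
    b k * (t - θ[ k ]) ∎

  -- Inverse of Carlitz's ℓ_k = ∏_{1≤i≤k} (θ - θ_i). The factors are the negatives of the brackets,
  -- which absorbs the sign of each Artin-Schreier sum.
  ℓ⁻¹ : ℕ → Carrier
  ℓ⁻¹ zero    = 1#
  ℓ⁻¹ (suc k) = ℓ⁻¹ k * (θ - θ[ suc k ]) ⁻¹

  θ-θ[]≈-[+1] : ∀ k → θ - θ[ suc k ] ≈ - [ k +1]
  θ-θ[]≈-[+1] k = solve 2 (λ θ n → θ :- n := :- (n :- θ)) refl θ θ[ suc k ]

  θ-θ[]-nonzero : ∀ k → ¬ θ - θ[ suc k ] ≈ 0#
  θ-θ[]-nonzero k eq = [+1]-nonzero k (begin
    [ k +1]         ≈⟨ -‿involutive _ ⟨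
    - - [ k +1]     ≈⟨ -‿cong (θ-θ[]≈-[+1] k) ⟨
    - (θ - θ[ suc k ])  ≈⟨ -‿cong eq ⟩
    - 0#            ≈⟨ -0#≈0# ⟩
    0#              ∎)

  -- The coefficient of θ^k is summed last; this is an Artin–Schreier sum in x k z.
  ∑-coset : ∀ k z w → (∀ as → length as ≡ k → ¬ z + ⟪ as ⟫ θ ≈ 0#) →
            ¬ x k z ≈ 0# ×
            ∑ (words k) (λ as → (w + ⟪ as ⟫ t) * (z + ⟪ as ⟫ θ) ⁻¹) ≈ y k z w * ℓ⁻¹ k * x k z ⁻¹
  ∑-coset zero z w nz = (λ z≈0 → nz [] ≡.refl (trans (+-identityʳ z) z≈0)) , (begin
    (w + 0#) * (z + 0#) ⁻¹ + 0#   ≈⟨ +-identityʳ _ ⟩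
    (w + 0#) * (z + 0#) ⁻¹        ≈⟨ *-cong (trans (+-identityʳ w) (sym (*-identityʳ w))) (⁻¹-cong (+-identityʳ z)) ⟩
    w * 1# * z ⁻¹                 ∎)
  ∑-coset (suc k) z w nz = *-nonzero D≉0 (⁻¹-nonzero ([+1]-nonzero k)) , (begin
    ∑ (words (suc k)) (λ as → (w + ⟪ as ⟫ t) * (z + ⟪ as ⟫ θ) ⁻¹)
      ≈⟨ ∑-words-∷ʳ k _ ⟩
    ∑ elements (λ a → ∑ (words k) (λ as → (w + ⟪ as ∷ʳ a ⟫ t) * (z + ⟪ as ∷ʳ a ⟫ θ) ⁻¹))
      ≈⟨ ∑-cong elements (λ a → ∑-cong-All (All.map (λ {as} |as|≡k →
           *-cong (shifted a as |as|≡k w t) (⁻¹-cong (shifted a as |as|≡k z θ))) (words-length k))) ⟩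
    ∑ elements (λ a → ∑ (words k) (λ as → ((ι a * t ^ k + w) + ⟪ as ⟫ t) * ((ι a * θ ^ k + z) + ⟪ as ⟫ θ) ⁻¹))
      ≈⟨ ∑-cong elements (λ a → proj₂ (IH a)) ⟩
    ∑ elements (λ a → y k (ι a * θ ^ k + z) (ι a * t ^ k + w) * ℓ⁻¹ k * x k (ι a * θ ^ k + z) ⁻¹)
      -- Partial fractions in `ι a`: the part `B * ℓ⁻¹ k` is independent of `a`, so it is summed q
      -- times and disappears.
      ≈⟨ ∑-cong elements summand ⟩
    ∑ elements (λ a → ℓ⁻¹ k * (Y - B * X) * (X + ι a) ⁻¹ + B * ℓ⁻¹ k)
      ≈⟨ trans (∑-+ elements _ _) (+-cong (∑-*ˡ elements _ _) (∑ι≈0 _)) ⟩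
    ℓ⁻¹ k * (Y - B * X) * S + 0#
      ≈⟨ trans (+-identityʳ _) (*-congˡ S≈) ⟩
    ℓ⁻¹ k * (Y - B * X) * ((θ - θ[ suc k ]) ⁻¹ * x (suc k) z ⁻¹)
      ≈⟨ solve 4 (λ l y u v → l :* y :* (u :* v) := y :* (l :* u) :* v) refl _ _ _ _ ⟩
    (Y - B * X) * (ℓ⁻¹ k * (θ - θ[ suc k ]) ⁻¹) * x (suc k) z ⁻¹ ∎)
    where
    X = x k z
    Y = y k z w
    B = b k
    S = ∑ elements (λ a → (X + ι a) ⁻¹)

    shifted : ∀ a as → length as ≡ k → ∀ w s → w + ⟪ as ∷ʳ a ⟫ s ≈ (ι a * s ^ k + w) + ⟪ as ⟫ s
    shifted a as ≡.refl w s = trans (+-congˡ (eval-∷ʳ as a s))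
      (solve 3 (λ w u v → w :+ (u :+ v) := u :+ w :+ v) refl w _ _)

    -- The top term a X^k is moved into the base point (z, w), leaving a coset of polynomials of
    -- degree below k.
    IH : ∀ a → _
    IH a = ∑-coset k (ι a * θ ^ k + z) (ι a * t ^ k + w) λ as |as|≡k eq →
      nz (as ∷ʳ a) (≡.trans (List.length-++ as) (≡.trans (ℕ.+-comm (length as) 1) (≡.cong suc |as|≡k)))
         (trans (shifted a as |as|≡k z θ) eq)

    x-shifted : ∀ a → x k (ι a * θ ^ k + z) ≈ X + ι a
    x-shifted a = trans (x-linear k a _ z) (trans (+-congʳ (trans (*-congˡ (x-θ^ k)) (*-identityʳ _))) (+-comm _ _))

    y-shifted : ∀ a → y k (ι a * θ ^ k + z) (ι a * t ^ k + w) ≈ ι a * B + Y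
    y-shifted a = trans (y-linear k a _ z _ w) (+-congʳ (*-congˡ (y-θ^ k)))

    -- The non-vanishing half of the induction hypothesis is what licenses the Artin-Schreier sum;
    -- hence both halves are proved together.
    X+a≉0 : ∀ a → ¬ X + ι a ≈ 0#
    X+a≉0 a eq = proj₁ (IH a) (trans (x-shifted a) eq)

    D≉0 : ¬ X ^ q - X ≈ 0#
    D≉0 = artin-schreier-nonzero X+a≉0

    summand : ∀ a → y k (ι a * θ ^ k + z) (ι a * t ^ k + w) * ℓ⁻¹ k * x k (ι a * θ ^ k + z) ⁻¹ ≈
                    ℓ⁻¹ k * (Y - B * X) * (X + ι a) ⁻¹ + B * ℓ⁻¹ k
    summand a = begin
      _ ≈⟨ *-cong (*-congʳ (y-shifted a)) (⁻¹-cong (x-shifted a)) ⟩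
      (ι a * B + Y) * ℓ⁻¹ k * (X + ι a) ⁻¹
        ≈⟨ solve 6 (λ a b y l x i → (a :* b :+ y) :* l :* i := l :* (y :- b :* x) :* i :+ b :* l :* ((x :+ a) :* i)) refl (ι a) B Y (ℓ⁻¹ k) X _ ⟩
      ℓ⁻¹ k * (Y - B * X) * (X + ι a) ⁻¹ + B * ℓ⁻¹ k * ((X + ι a) * (X + ι a) ⁻¹)
        ≈⟨ +-congˡ (trans (*-congˡ (inverseʳ (X+a≉0 a))) (*-identityʳ _)) ⟩
      ℓ⁻¹ k * (Y - B * X) * (X + ι a) ⁻¹ + B * ℓ⁻¹ k ∎

    S≈ : S ≈ (θ - θ[ suc k ]) ⁻¹ * x (suc k) z ⁻¹
    S≈ = trans (⁻¹-unique (begin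
      (θ - θ[ suc k ]) * x (suc k) z * S      ≈⟨ *-congʳ (*-congʳ (θ-θ[]≈-[+1] k)) ⟩
      (- [ k +1]) * x (suc k) z * S           ≈⟨ *-congʳ (trans (sym (-‿distribˡ-* _ _)) (-‿cong ([+1]*x k z))) ⟩
      - (X ^ q - X) * S                       ≈⟨ -‿distribˡ-* _ _ ⟨
      - ((X ^ q - X) * S)                     ≈⟨ -‿cong (artin-schreier-sum X+a≉0) ⟩
      - - 1#                                  ≈⟨ -‿involutive 1# ⟩
      1#                                      ∎))
      (⁻¹-distrib-* (θ-θ[]-nonzero k) (*-nonzero D≉0 (⁻¹-nonzero ([+1]-nonzero k))))

  term : List F.Carrier → Carrier
  term as = ⟪ monic F as ⟫ t * ⟪ monic F as ⟫ θ ⁻¹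

  -- Monic polynomials of degree k form the coset of X^k, so the base point is (θ^k, t^k). There the
  -- divided difference is 1 and the interpolation error is `b k`.
  ∑-degree : ∀ k → ∑ (words k) term ≈ b k * ℓ⁻¹ k
  ∑-degree k = begin
    ∑ (words k) term
      ≈⟨ ∑-cong-All (All.map (λ {as} |as|≡k → *-cong (eval-monic as |as|≡k t) (⁻¹-cong (eval-monic as |as|≡k θ))) (words-length k)) ⟩
    ∑ (words k) (λ as → (t ^ k + ⟪ as ⟫ t) * (θ ^ k + ⟪ as ⟫ θ) ⁻¹)
      ≈⟨ proj₂ (∑-coset k (θ ^ k) (t ^ k) λ as |as|≡k eq → θ-transcendental (as , trans (eval-monic as |as|≡k θ) eq)) ⟩
    y k (θ ^ k) (t ^ k) * ℓ⁻¹ k * x k (θ ^ k) ⁻¹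
      ≈⟨ *-cong (*-congʳ (y-θ^ k)) (trans (⁻¹-cong (x-θ^ k)) (sym (⁻¹-unique (*-identityˡ 1#)))) ⟩
    b k * ℓ⁻¹ k * 1#
      ≈⟨ *-identityʳ _ ⟩
    b k * ℓ⁻¹ k ∎
    where
    eval-monic : ∀ as → length as ≡ k → ∀ s → ⟪ monic F as ⟫ s ≈ s ^ k + ⟪ as ⟫ s
    eval-monic as ≡.refl s = trans (eval-∷ʳ as F.1# s) (+-congʳ (trans (*-congʳ ι-1) (*-identityˡ _)))

  ∏-ratio : ℕ → Carrier
  ∏-ratio zero    = 1#
  ∏-ratio (suc n) = (t - θ[ suc n ]) * (θ - θ[ suc n ]) ⁻¹ * ∏-ratio n

  -- Since `b` starts at the node θ_0 = θ and `∏-ratio` at θ_1, the factor t - θ is left over. It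
  -- expresses the sum in degree n + 1 through the total up to degree n.
  b*ℓ⁻¹ : ∀ n → b (suc n) * ℓ⁻¹ n ≈ (t - θ) * ∏-ratio n
  b*ℓ⁻¹ zero    = trans (*-congʳ (*-congˡ (+-congˡ (-‿cong θ[0]≈θ))))
    (solve 1 (λ u → con 1ℤ :* u :* con 1ℤ := u :* con 1ℤ) refl (t - θ))
  b*ℓ⁻¹ (suc n) = begin
    b (suc n) * (t - θ[ suc n ]) * (ℓ⁻¹ n * (θ - θ[ suc n ]) ⁻¹)
      ≈⟨ solve 4 (λ b u l i → b :* u :* (l :* i) := u :* i :* (b :* l)) refl _ _ _ _ ⟩
    (t - θ[ suc n ]) * (θ - θ[ suc n ]) ⁻¹ * (b (suc n) * ℓ⁻¹ n)
      ≈⟨ *-congˡ (b*ℓ⁻¹ n) ⟩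
    (t - θ[ suc n ]) * (θ - θ[ suc n ]) ⁻¹ * ((t - θ) * ∏-ratio n)
      ≈⟨ solve 3 (λ u v w → u :* (v :* w) := v :* (u :* w)) refl _ _ _ ⟩
    (t - θ) * ((t - θ[ suc n ]) * (θ - θ[ suc n ]) ⁻¹ * ∏-ratio n) ∎

  ∑-words≤ : ∀ n → ∑ (words≤ n) term ≈ ∏-ratio n
  ∑-words≤ zero    = trans (∑-degree 0) (*-identityʳ 1#)
  ∑-words≤ (suc n) = begin
    ∑ (words≤ n ++ words (suc n)) term
      ≈⟨ ∑-++ (words≤ n) _ term ⟩
    ∑ (words≤ n) term + ∑ (words (suc n)) term
      ≈⟨ +-cong (∑-words≤ n) (∑-degree (suc n)) ⟩
    P + b (suc n) * (ℓ⁻¹ n * i)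
      ≈⟨ +-cong (sym (trans (*-congʳ (inverseʳ (θ-θ[]-nonzero n))) (*-identityˡ P)))
                (trans (sym (*-assoc _ _ _)) (*-congʳ (b*ℓ⁻¹ n))) ⟩
    -- The numerators add up as (θ - θ_(n+1)) + (t - θ) = t - θ_(n+1).
    (θ - θ[ suc n ]) * i * P + (t - θ) * P * i
      ≈⟨ solve 5 (λ θ n t i p → (θ :- n) :* i :* p :+ (t :- θ) :* p :* i := (t :- n) :* i :* p) refl θ θ[ suc n ] t i P ⟩
    (t - θ[ suc n ]) * i * P ∎
    where
    P = ∏-ratio n
    i = (θ - θ[ suc n ]) ⁻¹

-- Valuations

module Exponents where
  open import Data.Integer.Base using (+_; -[1+_])

  -- Only these exponents serve as bounds; by `archimedean` they go below every rational.
  -[_] : ℕ → ℚ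
  -[ zero ]  = 0ℚ
  -[ suc n ] = -[ n ] ℚ.- 1ℚ

  -[]-+ : ∀ m n → -[ m ] ℚ.+ -[ n ] ≡ -[ m ℕ.+ n ]
  -[]-+ zero    n = ℚ.+-identityˡ _
  -[]-+ (suc m) n = begin
    -[ m ] ℚ.- 1ℚ ℚ.+ -[ n ]       ≡⟨ ℚ.+-assoc -[ m ] _ _ ⟩
    -[ m ] ℚ.+ (ℚ.- 1ℚ ℚ.+ -[ n ]) ≡⟨ ≡.cong (-[ m ] ℚ.+_) (ℚ.+-comm (ℚ.- 1ℚ) -[ n ]) ⟩
    -[ m ] ℚ.+ (-[ n ] ℚ.- 1ℚ)     ≡⟨ ℚ.+-assoc -[ m ] _ _ ⟨
    -[ m ] ℚ.+ -[ n ] ℚ.- 1ℚ       ≡⟨ ≡.cong (ℚ._- 1ℚ) (-[]-+ m n) ⟩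
    -[ m ℕ.+ n ] ℚ.- 1ℚ            ∎
    where open ≡.≡-Reasoning

  p-1<p : ∀ p → p ℚ.- 1ℚ ℚ.< p
  p-1<p p = ≡.subst (p ℚ.- 1ℚ ℚ.<_) (ℚ.+-identityʳ p) (ℚ.+-monoʳ-< p (ℚ.negative⁻¹ (ℚ.- 1ℚ)))

  <⇒≱ : ∀ {p q} → p ℚ.< q → ¬ q ℚ.≤ p
  <⇒≱ p<q q≤p = ℚ.<-irrefl ≡.refl (ℚ.<-≤-trans p<q q≤p)

  -[]-anti-≤ : ∀ {m n} → m ℕ.≤ n → -[ n ] ℚ.≤ -[ m ]
  -[]-anti-≤ {n = n} m≤n = go (ℕ.≤⇒≤′ m≤n)
    where
    go : ∀ {m n} → m ℕ.≤′ n → -[ n ] ℚ.≤ -[ m ]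
    go (ℕ.≤′-reflexive ≡.refl) = ℚ.≤-refl
    go (ℕ.≤′-step m≤n)         = ℚ.≤-trans (ℚ.<⇒≤ (p-1<p _)) (go m≤n)

  toℚᵘ-[] : ∀ n → ℚ.toℚᵘ -[ n ] ℚᵘ.≃ mkℚᵘ (ℤ.- (+ n)) 0
  toℚᵘ-[] zero    = ℚᵘ.≃-refl
  toℚᵘ-[] (suc n) = ℚᵘ.≃-trans (ℚ.toℚᵘ-homo-+ -[ n ] (ℚ.- 1ℚ))
    (ℚᵘ.≃-trans (ℚᵘ.+-congˡ (ℚ.toℚᵘ (ℚ.- 1ℚ)) (toℚᵘ-[] n)) (*≡* (eq n)))
    where
    eq : ∀ n → ((ℤ.- (+ n)) ℤ.* + 1 ℤ.+ -[1+ 0 ] ℤ.* + 1) ℤ.* + 1 ≡ -[1+ n ] ℤ.* + 1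
    eq zero    = ≡.refl
    eq (suc n) = ≡.cong (ℤ._* + 1) (≡.trans (≡.cong (ℤ._+ -[1+ 0 ]) (ℤ.*-identityʳ -[1+ n ])) (≡.cong (λ k → -[1+ suc k ]) (ℕ.+-identityʳ n)))

  archimedean : ∀ r → ∃[ n ] -[ n ] ℚ.≤ r
  archimedean r@(mkℚ i d _) = n , ℚ.toℚᵘ-cancel-≤ (ℚᵘ.≤-respˡ-≃ (ℚᵘ.≃-sym (toℚᵘ-[] n)) (*≤* le))
    where
    -- The numerator is enough, because the denominator is at least 1.
    n = ℤ.∣ i ∣
    -∣i∣≤i : ∀ i → ℤ.- (+ ℤ.∣ i ∣) ℤ.≤ i
    -∣i∣≤i (+ n)    = ℤ.≤-trans (ℤ.neg-mono-≤ (ℤ.+≤+ z≤n)) (ℤ.+≤+ z≤n)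
    -∣i∣≤i -[1+ n ] = ℤ.≤-refl
    le : ℤ.- (+ n) ℤ.* + suc d ℤ.≤ i ℤ.* + 1
    le = ≡.subst₂ ℤ._≤_ (ℤ.neg-distribˡ-* (+ n) (+ suc d)) (≡.sym (ℤ.*-identityʳ i))
      (ℤ.≤-trans (ℤ.neg-mono-≤ (≡.subst (+ n ℤ.≤_) (ℤ.pos-* n (suc d)) (ℤ.+≤+ (ℕ.m≤m*n n (suc d))))) (-∣i∣≤i i))

  p+p≡p⇒p≡0 : ∀ {p} → p ℚ.+ p ≡ p → p ≡ 0ℚ
  p+p≡p⇒p≡0 = Algebra.Properties.Group.identityʳ-unique ℚ.+-0-group _ _

  zipWith-+-≤ : ∀ {d e p q} → d ≤₋ just p → e ≤₋ just q → zipWith ℚ._+_ d e ≤₋ just (p ℚ.+ q)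
  zipWith-+-≤ (⊥₋≤ _) _       = ⊥₋≤ _
  zipWith-+-≤ [ _ ]   (⊥₋≤ _) = ⊥₋≤ _
  zipWith-+-≤ [ a≤p ] [ b≤q ] = [ ℚ.+-mono-≤ a≤p b≤q ]

open Exponents

module Valuation {c ℓ} (V : ValuedField c ℓ) where
  open ValuedField V using (underlying; deg; deg-cong; deg-zero; deg-*; deg-+; _⟶_; IsCauchy; IsComplete; IsSeriesSum)
  open FieldProperties underlying
  open import Relation.Binary.Reasoning.Setoid setoid

  -- The bound |x| ≤ q^(-n), kept as a record so that `n` and `x` can be inferred by unification.
  record Small (n : ℕ) (x : Carrier) : Set where
    constructor small
    field deg≤ : deg x ≤₋ just -[ n ]
  open Small

  S-cong : ∀ {n x y} → x ≈ y → Small n x → Small n y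
  S-cong x≈y (small s) = small (≡.subst (_≤₋ _) (deg-cong x≈y) s)

  S-0 : ∀ n → Small n 0#
  S-0 n = small (≡.subst (_≤₋ _) (≡.sym (Equivalence.from (deg-zero 0#) refl)) (⊥₋≤ _))

  S-+ : ∀ {n x y} → Small n x → Small n y → Small n (x + y)
  S-+ (small sx) (small sy) = small (deg-+ _ _ _ sx sy)

  S-* : ∀ {m n x y} → Small m x → Small n y → Small (m ℕ.+ n) (x * y)
  S-* {m} {n} {x} {y} (small sx) (small sy) =
    small (≡.subst₂ _≤₋_ (≡.sym (deg-* x y)) (≡.cong just (-[]-+ m n)) (zipWith-+-≤ sx sy))

  S-mono : ∀ {m n x} → m ℕ.≤ n → Small n x → Small m x
  S-mono m≤n (small sx) = small (≤₋-trans ℚ.≤-trans sx [ -[]-anti-≤ m≤n ])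

  deg-1 : deg 1# ≡ just 0ℚ
  deg-1 with deg 1# in eq | ≡.trans (deg-cong (sym (*-identityˡ 1#))) (deg-* 1# 1#)
  ... | nothing | _ = contradiction (Equivalence.to (deg-zero 1#) eq) 1≉0
  ... | just p | eq′ = ≡.cong just (p+p≡p⇒p≡0 (just-injective (≡.sym eq′)))

  S-1 : Small 0 1#
  S-1 = small (≡.subst (_≤₋ _) (≡.sym deg-1) [ ℚ.≤-refl ])

  ¬S-1 : ¬ Small 1 1#
  ¬S-1 (small s) = case ≡.subst (_≤₋ _) deg-1 s of λ { [ 0≤-1 ] → <⇒≱ (p-1<p 0ℚ) 0≤-1 }

  private
    deg-^ : ∀ {x p} n → deg x ≡ just p → 0ℚ ℚ.< p → ∃[ r ] deg (x ^ suc n) ≡ just r × 0ℚ ℚ.< r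
    deg-^ {x} {p} zero eq 0<p = p , ≡.trans (deg-cong (*-identityʳ x)) eq , 0<p
    deg-^ {x} {p} (suc n) eq 0<p with deg-^ n eq 0<p
    ... | r , eq′ , 0<r = p ℚ.+ r , ≡.trans (deg-* x _) (≡.cong₂ (zipWith ℚ._+_) eq eq′) , ℚ.+-mono-< 0<p 0<r

  -- Powers of an element of positive degree have positive degree. This gives access to roots of
  -- unity and to λ, whose degree 1/(q-1) need not be an integer.
  S-root : ∀ {x} n → Small 0 (x ^ suc n) → Small 0 x
  S-root {x} n (small s) = small (bound (deg x) ≡.refl)
    where
    bound : ∀ d → deg x ≡ d → d ≤₋ just 0ℚ
    bound nothing  eq = ⊥₋≤ _
    bound (just p) eq with p ℚ.≤? 0ℚ
    ... | yes p≤0 = [ p≤0 ]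
    ... | no  p≰0 with deg-^ n eq (ℚ.≰⇒> p≰0)
    ...   | r , eq′ , 0<r = case ≡.subst (_≤₋ _) eq′ s of λ { [ r≤0 ] → contradiction r≤0 (<⇒≱ 0<r) }

  -- The axioms for `deg` do not mention negation; |-1| ≤ 1 follows from (-1)^2 = 1 by `S-root`.
  S-neg : ∀ {n x} → Small n x → Small n (- x)
  S-neg {n} {x} s = S-cong (trans (sym (-‿distribˡ-* 1# x)) (-‿cong (*-identityˡ x)))
    (S-* {0} (S-root 1 (S-cong (solve 0 (con 1ℤ := :- con 1ℤ :* (:- con 1ℤ :* con 1ℤ)) refl) S-1)) s)

  S-- : ∀ {n x y} → Small n x → Small n y → Small n (x - y)
  S-- sx sy = S-+ sx (S-neg sy)

  S-*₀ : ∀ {n x y} → Small 0 x → Small n y → Small n (x * y)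
  S-*₀ = S-*

  S-*₀ʳ : ∀ {n x y} → Small n x → Small 0 y → Small n (x * y)
  S-*₀ʳ sx sy = S-cong (*-comm _ _) (S-*₀ sy sx)

  S-^₀ : ∀ {x} n → Small 0 x → Small 0 (x ^ n)
  S-^₀ zero    sx = S-1
  S-^₀ (suc n) sx = S-*₀ sx (S-^₀ n sx)

  S-^suc : ∀ {n x} m → Small n x → Small n (x ^ suc m)
  S-^suc m sx = S-*₀ʳ sx (S-^₀ m (S-mono z≤n sx))

  S-^ : ∀ {x} n → Small 1 x → Small n (x ^ n)
  S-^ zero    sx = S-1
  S-^ (suc n) sx = S-* sx (S-^ n sx)

  S-∑ : ∀ {n i} {I : Set i} {is : List I} {f} → All (λ i → Small n (f i)) is → Small n (∑ is f)
  S-∑ {n} []        = S-0 n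
  S-∑ (sf ∷ sfs) = S-+ sf (S-∑ sfs)

  -- Degrees are data: comparing `deg x` with `nothing` decides whether x vanishes.
  ≈0? : ∀ x → Dec (x ≈ 0#)
  ≈0? x with deg x in eq
  ... | nothing = yes (Equivalence.to (deg-zero x) eq)
  ... | just _  = no λ x≈0 → case ≡.trans (≡.sym eq) (Equivalence.from (deg-zero x) x≈0) of λ ()

  x^m≈x⇒S : ∀ {x m} → 2 ℕ.≤ m → x ^ m ≈ x → Small 0 x
  x^m≈x⇒S {x} (s≤s (s≤s {n = n} _)) eq with ≈0? x
  ... | yes x≈0 = S-cong (sym x≈0) (S-0 0)
  ... | no  x≉0 = S-root n (S-cong (sym (x≉0∧x^[1+n]≈x⇒x^n≈1 (suc n) x≉0 eq)) S-1)

  S-1-u-nonzero : ∀ {u} → Small 1 u → ¬ 1# - u ≈ 0#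
  S-1-u-nonzero su eq = ¬S-1 (S-cong (sym (x-y≈0⇒x≈y 1# _ eq)) su)

  -- The inverse v satisfies v = 1 + uv with |uv| ≤ |v|/q. If |v|/q ≤ 1, both summands are at most
  -- 1; otherwise |v| ≤ |v|/q, which is absurd.
  S-[1-u]⁻¹ : ∀ {u} → Small 1 u → Small 0 ((1# - u) ⁻¹)
  S-[1-u]⁻¹ {u} su = bound (deg v) ≡.refl
    where
    v = (1# - u) ⁻¹
    v≈1+uv : v ≈ 1# + u * v
    v≈1+uv = begin
      v                      ≈⟨ solve 2 (λ u v → v := (con 1ℤ :- u) :* v :+ u :* v) refl u v ⟩
      (1# - u) * v + u * v   ≈⟨ +-congʳ (inverseʳ (S-1-u-nonzero su)) ⟩
      1# + u * v             ∎
    bound : ∀ d → deg v ≡ d → Small 0 v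
    bound nothing  eq = small (≡.subst (_≤₋ _) (≡.sym eq) (⊥₋≤ _))
    bound (just r) eq = case ℚ.≤-total (-[ 1 ] ℚ.+ r) 0ℚ of λ
      { (inj₁ r-1≤0) → S-cong (sym v≈1+uv) (S-+ S-1 (small (≤₋-trans ℚ.≤-trans deg-uv [ r-1≤0 ])))
      ; (inj₂ 0≤r-1) → contradiction
        ([≤]-injective (≡.subst (_≤₋ _) eq (≡.subst (_≤₋ _) (deg-cong (sym v≈1+uv)) (deg-+ _ _ _ (≤₋-trans ℚ.≤-trans (deg≤ S-1) [ 0≤r-1 ]) deg-uv))))
        (<⇒≱ (≡.subst (ℚ._< r) (ℚ.+-comm r -[ 1 ]) (p-1<p r)))
      }
      where
      deg-uv : deg (u * v) ≤₋ just (-[ 1 ] ℚ.+ r)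
      deg-uv = ≡.subst (_≤₋ _) (≡.sym (deg-* u v)) (zipWith-+-≤ (deg≤ su) (≡.subst (_≤₋ just r) (≡.sym eq) [ ℚ.≤-refl ]))

  infix 4 _⇢_
  -- Equivalent to `_⟶_`, with natural thresholds so that limits can be handled by the `Small`
  -- calculus.
  _⇢_ : (ℕ → Carrier) → Carrier → Set
  u ⇢ l = ∀ n → ∃[ N ] ∀ m → N ℕ.≤ m → Small n (u m - l)

  ⟶⇒⇢ : ∀ {u l} → u ⟶ l → u ⇢ l
  ⟶⇒⇢ u⟶l n = let N , s = u⟶l -[ n ] in N , λ m N≤m → small (s m N≤m)

  ⇢⇒⟶ : ∀ {u l} → u ⇢ l → u ⟶ l
  ⇢⇒⟶ u⇢l r with archimedean r
  ... | n , -n≤r with u⇢l n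
  ...   | N , s = N , λ m N≤m → ≤₋-trans ℚ.≤-trans (deg≤ (s m N≤m)) [ -n≤r ]

  S-all⇒0 : ∀ {x} → (∀ n → Small n x) → x ≈ 0#
  S-all⇒0 {x} s = Equivalence.to (deg-zero x) (infinite (deg x) (λ n → deg≤ (s n)))
    where
    infinite : ∀ d → (∀ n → d ≤₋ just -[ n ]) → d ≡ nothing
    infinite nothing  _ = ≡.refl
    infinite (just r) s with archimedean r
    ... | n , -n≤r = contradiction (ℚ.≤-trans -n≤r ([≤]-injective (s (suc n)))) (<⇒≱ (p-1<p -[ n ]))

  ⇢-unique : ∀ {u l l′} → u ⇢ l → u ⇢ l′ → l ≈ l′
  ⇢-unique {u} {l} {l′} u⇢l u⇢l′ = x-y≈0⇒x≈y l l′ (S-all⇒0 λ n →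
    let N , s = u⇢l n ; N′ , s′ = u⇢l′ n ; m = N ℕ.+ N′ in
    S-cong (solve 3 (λ u l l′ → (u :- l′) :- (u :- l) := l :- l′) refl (u m) l l′)
      (S-- (s′ m (ℕ.m≤n+m N′ N)) (s m (ℕ.m≤m+n N N′))))

  ⇢-cong : ∀ {u v l} → (∀ n → u n ≈ v n) → u ⇢ l → v ⇢ l
  ⇢-cong u≈v u⇢l n = let N , s = u⇢l n in N , λ m N≤m → S-cong (+-congʳ (u≈v m)) (s m N≤m)

  ⇢-unsuc : ∀ {u l} → (λ n → u (suc n)) ⇢ l → u ⇢ l
  ⇢-unsuc u⇢l n = let N , s = u⇢l n in suc N , λ { (suc m) (s≤s N≤m) → s m N≤m }

  ⇢-suc : ∀ {u l} → u ⇢ l → (λ n → u (suc n)) ⇢ l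
  ⇢-suc u⇢l n = let N , s = u⇢l n in N , λ m N≤m → s (suc m) (ℕ.m≤n⇒m≤1+n N≤m)

  ⇢-+ : ∀ {u v l l′} → u ⇢ l → v ⇢ l′ → (λ n → u n + v n) ⇢ (l + l′)
  ⇢-+ {u} {v} {l} {l′} u⇢l v⇢l′ n =
    let N , s = u⇢l n ; N′ , s′ = v⇢l′ n in
    N ℕ.+ N′ , λ m N+N′≤m →
      S-cong (solve 4 (λ u v l l′ → (u :- l) :+ (v :- l′) := (u :+ v) :- (l :+ l′)) refl (u m) (v m) l l′)
        (S-+ (s m (ℕ.m+n≤o⇒m≤o N N+N′≤m)) (s′ m (ℕ.m+n≤o⇒n≤o N N+N′≤m)))

  ⇢-limit-S : ∀ {u l k x} N → (∀ n → N ℕ.≤ n → Small k (u n - x)) → u ⇢ l → Small k (l - x)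
  ⇢-limit-S {u} {l} {k} {x} N s u⇢l =
    let N′ , s′ = u⇢l k ; m = N ℕ.+ N′ in
    S-cong (solve 3 (λ u l x → (u :- x) :- (u :- l) := l :- x) refl (u m) l x)
      (S-- (s m (ℕ.m≤m+n N N′)) (s′ m (ℕ.m≤n+m N′ N)))

  Σ<-suc : ∀ n f → Σ< (suc n) f ≈ Σ< n f + f n
  Σ<-suc zero    f = +-comm (f 0) 0#
  Σ<-suc (suc n) f = trans (+-congˡ (Σ<-suc n (λ i → f (suc i)))) (sym (+-assoc _ _ _))

  ∏<-suc : ∀ n f → ∏< (suc n) f ≈ ∏< n f * f n
  ∏<-suc zero    f = *-comm (f 0) 1#
  ∏<-suc (suc n) f = trans (*-congˡ (∏<-suc n (λ i → f (suc i)))) (sym (*-assoc _ _ _))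

  -- In an ultrametric field a tail is bounded by its largest term. The term `f 0` is left free
  -- because η_0 and s_0^q, the first terms in two applications, have absolute value above 1.
  series-converges : IsComplete → ∀ j f → (∀ n → Small (j ℕ.+ n) (f (suc n))) →
                     ∃[ s ] IsSeriesSum f s × Small j (s - f 0)
  series-converges complete j f sf = s , s-sum , ⇢-limit-S 1
    (λ { (suc n) _ → S-cong (+-congˡ (-‿cong (+-identityʳ (f 0)))) (S-mono (ℕ.m≤m+n j 0) (gap 0 n)) })
    (⟶⇒⇢ s-sum)
    where
    gap : ∀ m k → Small (j ℕ.+ m) (Σ< (suc m ℕ.+ k) f - Σ< (suc m) f)
    gap m zero = S-cong (trans (sym (-‿inverseʳ _)) (+-congʳ (reflexive (≡.cong (λ k → Σ< (suc k) f) (≡.sym (ℕ.+-identityʳ m)))))) (S-0 _)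
    gap m (suc k) = S-cong (begin
      (Σ< (suc m ℕ.+ k) f - Σ< (suc m) f) + f (suc m ℕ.+ k)
        ≈⟨ solve 3 (λ a b c → (a :- b) :+ c := a :+ c :- b) refl _ _ _ ⟩
      Σ< (suc m ℕ.+ k) f + f (suc m ℕ.+ k) - Σ< (suc m) f
        ≈⟨ +-congʳ (Σ<-suc (suc m ℕ.+ k) f) ⟨
      Σ< (suc (suc m ℕ.+ k)) f - Σ< (suc m) f
        ≡⟨ ≡.cong (λ n → Σ< n f - Σ< (suc m) f) (ℕ.+-suc (suc m) k) ⟨
      Σ< (suc m ℕ.+ suc k) f - Σ< (suc m) f ∎)
      (S-+ (gap m k) (S-mono (ℕ.+-monoʳ-≤ j (ℕ.m≤m+n m k)) (sf (m ℕ.+ k))))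

    gap-≤ : ∀ {m n} → m ℕ.≤ n → Small m (Σ< (suc n) f - Σ< (suc m) f)
    gap-≤ {m} m≤n = ≡.subst (λ n → Small m (Σ< (suc n) f - Σ< (suc m) f)) (ℕ.m+[n∸m]≡n m≤n)
      (S-mono (ℕ.m≤n+m m j) (gap m _))

    gap-any : ∀ N m n → N ℕ.≤ m → N ℕ.≤ n → Small N (Σ< (suc m) f - Σ< (suc n) f)
    gap-any N m n N≤m N≤n = S-cong
      (solve 3 (λ a b c → (a :- c) :- (b :- c) := a :- b) refl _ _ _)
      (S-- (gap-≤ N≤m) (gap-≤ N≤n))

    cauchy : IsCauchy (λ n → Σ< n f)
    cauchy r with archimedean r
    ... | N , -N≤r = suc N , λ { (suc m) (suc n) (s≤s N≤m) (s≤s N≤n) →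
      ≤₋-trans ℚ.≤-trans (deg≤ (gap-any N m n N≤m N≤n)) [ -N≤r ] }

    s = proj₁ (complete _ cauchy)
    s-sum = proj₂ (complete _ cauchy)

  module _ {θ} (deg-θ : deg θ ≡ just 1ℚ) where
    θ-nonzero : ¬ θ ≈ 0#
    θ-nonzero θ≈0 = case ≡.trans (≡.sym deg-θ) (Equivalence.from (deg-zero θ) θ≈0) of λ ()

    S-θ⁻¹ : Small 1 (θ ⁻¹)
    S-θ⁻¹ = small bound
      where
      bound : deg (θ ⁻¹) ≤₋ just -[ 1 ]
      bound with deg (θ ⁻¹) | ≡.trans (≡.sym (deg-* θ (θ ⁻¹))) (≡.trans (deg-cong (inverseʳ θ-nonzero)) deg-1)
      ... | nothing | _ = ⊥₋≤ _
      ... | just r | eq rewrite deg-θ = [ ℚ.≤-reflexive (≡.trans (Algebra.Properties.Group.inverseʳ-unique ℚ.+-0-group 1ℚ r (just-injective eq)) ≡.refl) ]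

    S-θ* : ∀ {n x} → Small (suc n) x → Small n (θ * x)
    S-θ* {n} {x} (small sx) = small (≡.subst₂ _≤₋_ (≡.sym (deg-* θ x)) (≡.cong just 1-[1+n])
      (zipWith-+-≤ (≡.subst (_≤₋ just 1ℚ) (≡.sym deg-θ) [ ℚ.≤-refl ]) sx))
      where
      1-[1+n] : 1ℚ ℚ.+ -[ suc n ] ≡ -[ n ]
      1-[1+n] = ≡.trans (≡.cong (1ℚ ℚ.+_) (ℚ.+-comm -[ n ] (ℚ.- 1ℚ))) (≡.trans (≡.sym (ℚ.+-assoc 1ℚ (ℚ.- 1ℚ) -[ n ])) (ℚ.+-identityˡ -[ n ]))

    S-θ^* : ∀ k {n x} → Small (k ℕ.+ n) x → Small n (θ ^ k * x)
    S-θ^* zero    sx = S-cong (sym (*-identityˡ _)) sx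
    S-θ^* (suc k) sx = S-cong (sym (*-assoc _ _ _)) (S-θ* (S-θ^* k (S-mono (ℕ.≤-reflexive (ℕ.+-suc k _)) sx)))

-- The Carlitz exponential and s_Car

module Tower {c ℓ} {q : ℕ} (T : CarlitzTower c ℓ q) where
  private
    module T = CarlitzTower T
    module 𝔽 = FieldProperties T.𝔽q
    module K = FieldProperties (ValuedField.underlying T.K)
    V = T.ℂ∞

  open Carlitz T using (𝔽q; ι; θ; bracket; d; IsCarlitzExp)
  open ValuedField V using (underlying; deg; IsComplete)
  open FieldProperties underlying
  open Valuation V
  open import Relation.Binary.Reasoning.Setoid setoid

  private
    open IsCompletion T.K∞-isCompletion using () renaming (isValuedExtension to ext₁)
    open IsAlgebraicClosure T.K∞alg-isAlgClosure using () renaming (isValuedExtension to ext₂)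
    open IsCompletion T.ℂ∞-isCompletion using (complete) renaming (isValuedExtension to ext₃)
    module ext₁ = IsValuedExtension ext₁
    module ext₂ = IsValuedExtension ext₂
    module ext₃ = IsValuedExtension ext₃

  K→ℂ∞ : K.Carrier → Carrier
  K→ℂ∞ = T.K∞alg→ℂ∞ ∘ T.K∞→K∞alg ∘ T.K→K∞

  K→ℂ∞-hom : IsFieldHom (ValuedField.underlying T.K) underlying K→ℂ∞
  K→ℂ∞-hom = Composition.isRingHomomorphism trans
    (Composition.isRingHomomorphism (ValuedField.trans T.K∞alg) ext₁.isFieldHom ext₂.isFieldHom) ext₃.isFieldHom

  ι-hom : IsFieldHom 𝔽q underlying ι
  ι-hom = Composition.isRingHomomorphism trans T.𝔽q→K-hom K→ℂ∞-hom

  ℂ∞-complete : IsComplete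
  ℂ∞-complete = complete

  deg-θ : deg θ ≡ just 1ℚ
  deg-θ = ≡.trans (ext₃.isometric _) (≡.trans (ext₂.isometric _) (≡.trans (ext₁.isometric _)
    (≡.trans (ValuedField.deg-cong T.K (K.sym evalK-X)) (T.deg-poly (𝔽.0# ∷ []) 𝔽.1# 𝔽.1≉0))))
    where
    module 𝔽q→K = IsRingHomomorphism T.𝔽q→K-hom
    evalK-X : T.evalK (𝔽.0# ∷ 𝔽.1# ∷ []) K.≈ T.θK
    evalK-X = K.trans (K.+-cong 𝔽q→K.0#-homo (K.*-congˡ (K.+-congʳ 𝔽q→K.1#-homo)))
      (K.solve 1 (λ x → K.con 0ℤ K.:+ x K.:* (K.con 1ℤ K.:+ x K.:* K.con 0ℤ) K.:= x) K.refl T.θK)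

  open FiniteField T.𝔽q T.𝔽q-card using (2≤q)
  open FiniteFieldExtension T.𝔽q T.𝔽q-card underlying ι ι-hom

  S-ι : ∀ a → Small 0 (ι a)
  S-ι a = x^m≈x⇒S 2≤q (ι-fermat a)

  θ≉0 : ¬ θ ≈ 0#
  θ≉0 = θ-nonzero deg-θ

  θ^≉0 : ∀ n → ¬ θ ^ n ≈ 0#
  θ^≉0 n = ^-nonzero n θ≉0

  S-θ^⁻¹ : ∀ n → Small n ((θ ^ n) ⁻¹)
  S-θ^⁻¹ n = S-cong (^-⁻¹ n θ≉0) (S-^ n (S-θ⁻¹ deg-θ))

  ⟪_⟫ : List 𝔽.Carrier → Carrier → Carrier
  ⟪ as ⟫ x = eval 𝔽q underlying ι as x

  S-eval : ∀ as {x} → Small 0 x → Small 0 (⟪ as ⟫ x)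
  S-eval []       sx = S-0 0
  S-eval (a ∷ as) sx = S-+ (S-ι a) (S-*₀ sx (S-eval as sx))

  -- The leading term dominates: a constant term c is written as θ^(n+1) times c θ^(-(n+1)), which
  -- only changes u. Both the transcendence of θ and the decay of 1/a(θ) follow.
  monic-factor : ∀ as → ∃[ u ] Small 1 u × ⟪ monic 𝔽q as ⟫ θ ≈ θ ^ length as * (1# - u)
  monic-factor [] = 0# , S-0 1 , trans (+-congʳ (IsRingHomomorphism.1#-homo ι-hom))
    (solve 1 (λ θ → con 1ℤ :+ θ :* con 0ℤ := con 1ℤ :* (con 1ℤ :- con 0ℤ)) refl θ)
  monic-factor (a ∷ as) with monic-factor as
  ... | u , su , eq = u - ι a * i , S-- su (S-*₀ (S-ι a) (S-mono (s≤s z≤n) (S-θ^⁻¹ (suc n)))) , (begin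
    ι a + θ * ⟪ monic 𝔽q as ⟫ θ
      ≈⟨ +-cong (trans (sym (*-identityʳ _)) (*-congˡ (sym (inverseʳ (θ^≉0 (suc n)))))) (*-congˡ eq) ⟩
    ι a * (θ ^ suc n * i) + θ * (θ ^ n * (1# - u))
      ≈⟨ solve 5 (λ a θ p i u → a :* (θ :* p :* i) :+ θ :* (p :* (con 1ℤ :- u)) := θ :* p :* (con 1ℤ :- (u :- a :* i))) refl (ι a) θ (θ ^ n) i u ⟩
    θ ^ suc n * (1# - (u - ι a * i)) ∎)
    where
    n = length as
    i = (θ ^ suc n) ⁻¹

  θ-transcendental : ¬ IsAlgebraic 𝔽q underlying ι θ
  θ-transcendental (as , eq) with monic-factor as
  ... | u , su , eq′ = *-nonzero (θ^≉0 (length as)) (S-1-u-nonzero su) (trans (sym eq′) eq)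

  S-monic⁻¹ : ∀ as → Small (length as) (⟪ monic 𝔽q as ⟫ θ ⁻¹)
  S-monic⁻¹ as with monic-factor as
  ... | u , su , eq = S-cong
    (trans (sym (⁻¹-distrib-* (θ^≉0 (length as)) (S-1-u-nonzero su))) (⁻¹-cong (sym eq)))
    (S-*₀ʳ (S-θ^⁻¹ (length as)) (S-[1-u]⁻¹ su))

  -- θ^(1 - q^(k+1)); the factors of the period product are the inverses of `1# - u[ k ]`.
  u[_] : ℕ → Carrier
  u[ k ] = θ / θ ^ (q ℕ.^ suc k)

  2≤q^[1+k] : ∀ k → 2 ℕ.≤ q ℕ.^ suc k
  2≤q^[1+k] k = ℕ.≤-trans (s≤s (s≤s z≤n)) (ℕ.≤-trans (ℕ.*-monoˡ-≤ 1 2≤q) (ℕ.*-monoʳ-≤ q (ℕ.m^n>0 q {{ℕ.>-nonZero (ℕ.≤-trans (s≤s z≤n) 2≤q)}} k)))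

  S-u[] : ∀ k → Small 1 u[ k ]
  S-u[] k = S-θ* deg-θ (S-mono (2≤q^[1+k] k) (S-θ^⁻¹ (q ℕ.^ suc k)))

  bracket≈ : ∀ k → bracket (suc k) ≈ θ ^ (q ℕ.^ suc k) * (1# - u[ k ])
  bracket≈ k = begin
    p - θ                    ≈⟨ +-congˡ (-‿cong (trans (sym (*-identityʳ θ)) (*-congˡ (sym (inverseʳ (θ^≉0 (q ℕ.^ suc k))))))) ⟩
    p - θ * (p * p ⁻¹)       ≈⟨ solve 3 (λ p θ i → p :- θ :* (p :* i) := p :* (con 1ℤ :- θ :* i)) refl p θ _ ⟩
    p * (1# - θ * p ⁻¹)      ∎
    where p = θ ^ (q ℕ.^ suc k)

  bracket-nonzero : ∀ k → ¬ bracket (suc k) ≈ 0#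
  bracket-nonzero k eq = *-nonzero (θ^≉0 (q ℕ.^ suc k)) (S-1-u-nonzero (S-u[] k)) (trans (sym (bracket≈ k)) eq)

  θ-aperiodic : ¬ FrobeniusPeriodic underlying q θ
  θ-aperiodic (k , eq) = bracket-nonzero k (x≈y⇒x-y≈0 eq)

  bracket⁻¹≈ : ∀ k → bracket (suc k) ⁻¹ ≈ (θ ^ (q ℕ.^ suc k)) ⁻¹ * (1# - u[ k ]) ⁻¹
  bracket⁻¹≈ k = trans (⁻¹-cong (bracket≈ k)) (⁻¹-distrib-* (θ^≉0 (q ℕ.^ suc k)) (S-1-u-nonzero (S-u[] k)))

  θ[]*bracket⁻¹ : ∀ k → θ ^ (q ℕ.^ suc k) * bracket (suc k) ⁻¹ ≈ (1# - u[ k ]) ⁻¹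
  θ[]*bracket⁻¹ k = trans (*-congˡ (bracket⁻¹≈ k)) (trans (sym (*-assoc _ _ _))
    (trans (*-congʳ (inverseʳ (θ^≉0 (q ℕ.^ suc k)))) (*-identityˡ _)))

  S-bracket⁻¹ : ∀ k → Small 1 (bracket (suc k) ⁻¹)
  S-bracket⁻¹ k = S-cong (sym (bracket⁻¹≈ k))
    (S-*₀ʳ (S-mono (ℕ.≤-trans (s≤s z≤n) (2≤q^[1+k] k)) (S-θ^⁻¹ (q ℕ.^ suc k))) (S-[1-u]⁻¹ (S-u[] k)))

  ∏<-cong : ∀ n {f g} → (∀ i → f i ≈ g i) → ∏< n f ≈ ∏< n g
  ∏<-cong zero    f≈g = refl
  ∏<-cong (suc n) f≈g = *-cong (f≈g 0) (∏<-cong n (λ i → f≈g (suc i)))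

  Σ<-cong : ∀ n {f g} → (∀ i → f i ≈ g i) → Σ< n f ≈ Σ< n g
  Σ<-cong zero    f≈g = refl
  Σ<-cong (suc n) f≈g = +-cong (f≈g 0) (Σ<-cong n (λ i → f≈g (suc i)))

  ∏<-^ : ∀ n f m → ∏< n f ^ m ≈ ∏< n (λ i → f i ^ m)
  ∏<-^ zero    f m = 1^n≈1 m
  ∏<-^ (suc n) f m = trans (^-distrib-* _ _ m) (*-congˡ (∏<-^ n (λ i → f (suc i)) m))

  ^[q^n]^q : ∀ x n → (x ^ (q ℕ.^ n)) ^ q ≈ x ^ (q ℕ.^ suc n)
  ^[q^n]^q x n = trans (^-assocʳ x (q ℕ.^ n) q) (^-congʳ x (ℕ.*-comm (q ℕ.^ n) q))

  frobenius-iterate : ∀ n x y → (x - y) ^ (q ℕ.^ n) ≈ x ^ (q ℕ.^ n) - y ^ (q ℕ.^ n)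
  frobenius-iterate zero    x y = trans (*-identityʳ _) (sym (+-cong (*-identityʳ x) (-‿cong (*-identityʳ y))))
  frobenius-iterate (suc n) x y = begin
    (x - y) ^ (q ℕ.^ suc n)                           ≈⟨ ^[q^n]^q _ n ⟨
    ((x - y) ^ (q ℕ.^ n)) ^ q                         ≈⟨ ^-congˡ q (frobenius-iterate n x y) ⟩
    (x ^ (q ℕ.^ n) - y ^ (q ℕ.^ n)) ^ q               ≈⟨ frobenius-- _ _ ⟩
    (x ^ (q ℕ.^ n)) ^ q - (y ^ (q ℕ.^ n)) ^ q         ≈⟨ +-cong (^[q^n]^q x n) (-‿cong (^[q^n]^q y n)) ⟩
    x ^ (q ℕ.^ suc n) - y ^ (q ℕ.^ suc n)             ∎

  S-^q : ∀ {n x} → Small n x → Small n (x ^ q)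
  S-^q {x = x} sx = S-cong (^-congʳ x suc-pred-q) (S-^suc (ℕ.pred q) sx)

  ⇢-^q : ∀ {u l} → u ⇢ l → (λ n → u n ^ q) ⇢ (l ^ q)
  ⇢-^q {u} {l} u⇢l n = let N , s = u⇢l n in N , λ m N≤m → S-cong (frobenius-- (u m) l) (S-^q (s m N≤m))

  d-suc : ∀ n → d (suc n) ≈ bracket (suc n) * d n ^ q
  d-suc n = *-cong (*-identityʳ _) (trans
    (∏<-cong n (λ j → sym (^[q^n]^q (bracket (n ℕ.∸ j)) j)))
    (sym (∏<-^ n (λ j → bracket (n ℕ.∸ j) ^ (q ℕ.^ j)) q)))

  d-nonzero : ∀ n → ¬ d n ≈ 0#
  d-nonzero zero    = 1≉0
  d-nonzero (suc n) eq = *-nonzero (bracket-nonzero n) (^-nonzero q (d-nonzero n)) (trans (sym (d-suc n)) eq)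

  exp-term : Carrier → ℕ → Carrier
  exp-term η n = η ^ (q ℕ.^ n) / d n

  exp-term-cong : ∀ {η η′} n → η ≈ η′ → exp-term η n ≈ exp-term η′ n
  exp-term-cong n eq = *-congʳ (^-congˡ (q ℕ.^ n) eq)

  exp-term-zero : ∀ η → exp-term η 0 ≈ η
  exp-term-zero η = trans (*-cong (*-identityʳ η) (sym (⁻¹-unique (*-identityˡ 1#)))) (*-identityʳ η)

  exp-term-suc : ∀ η n → exp-term η (suc n) ≈ exp-term η n ^ q * bracket (suc n) ⁻¹
  exp-term-suc η n = begin
    η ^ (q ℕ.^ suc n) * d (suc n) ⁻¹
      ≈⟨ *-cong (sym (^[q^n]^q η n)) (trans (⁻¹-cong (d-suc n)) (⁻¹-distrib-* (bracket-nonzero n) (^-nonzero q (d-nonzero n)))) ⟩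
    (η ^ (q ℕ.^ n)) ^ q * (bracket (suc n) ⁻¹ * (d n ^ q) ⁻¹)
      ≈⟨ *-congˡ (*-congˡ (^-⁻¹ q (d-nonzero n))) ⟨
    (η ^ (q ℕ.^ n)) ^ q * (bracket (suc n) ⁻¹ * (d n ⁻¹) ^ q)
      ≈⟨ solve 3 (λ a b c → a :* (b :* c) := a :* c :* b) refl _ _ _ ⟩
    (η ^ (q ℕ.^ n)) ^ q * (d n ⁻¹) ^ q * bracket (suc n) ⁻¹
      ≈⟨ *-congʳ (^-distrib-* _ _ q) ⟨
    exp-term η n ^ q * bracket (suc n) ⁻¹ ∎

  -- θ^(q^(n+1)) = θ + [n+1], and the bracket cancels the one in d_(n+1) = [n+1] d_n^q.
  exp-term-θ* : ∀ η n → exp-term (θ * η) (suc n) ≈ θ * exp-term η (suc n) + exp-term η n ^ q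
  exp-term-θ* η n = begin
    (θ * η) ^ (q ℕ.^ suc n) * d (suc n) ⁻¹
      ≈⟨ trans (*-congʳ (^-distrib-* θ η (q ℕ.^ suc n))) (*-assoc _ _ _) ⟩
    θ ^ (q ℕ.^ suc n) * X
      ≈⟨ solve 3 (λ p θ x → p :* x := θ :* x :+ (p :- θ) :* x) refl _ θ X ⟩
    θ * X + bracket (suc n) * X
      ≈⟨ +-congˡ (trans (*-congˡ (exp-term-suc η n)) (trans
           (solve 3 (λ b x i → b :* (x :* i) := x :* (b :* i)) refl _ _ _)
           (trans (*-congˡ (inverseʳ (bracket-nonzero n))) (*-identityʳ _)))) ⟩
    θ * X + exp-term η n ^ q ∎
    where X = exp-term η (suc n)

  -- The q-th power of term n contributes to term n + 1, so the sum under the power is one term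
  -- shorter.
  exp-sum-θ* : ∀ η n → Σ< (suc n) (exp-term (θ * η)) ≈ θ * Σ< (suc n) (exp-term η) + Σ< n (exp-term η) ^ q
  exp-sum-θ* η zero = begin
    exp-term (θ * η) 0 + 0#                 ≈⟨ +-congʳ (trans (exp-term-zero _) (*-congˡ (sym (exp-term-zero η)))) ⟩
    θ * exp-term η 0 + 0#                   ≈⟨ solve 2 (λ θ x → θ :* x :+ con 0ℤ := θ :* (x :+ con 0ℤ) :+ con 0ℤ) refl θ _ ⟩
    θ * (exp-term η 0 + 0#) + 0#            ≈⟨ +-congˡ 0^q≈0 ⟨
    θ * (exp-term η 0 + 0#) + 0# ^ q        ∎
  exp-sum-θ* η (suc n) = begin
    Σ< (suc (suc n)) (exp-term (θ * η))
      ≈⟨ Σ<-suc (suc n) (exp-term (θ * η)) ⟩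
    Σ< (suc n) (exp-term (θ * η)) + exp-term (θ * η) (suc n)
      ≈⟨ +-cong (exp-sum-θ* η n) (exp-term-θ* η n) ⟩
    (θ * Σ< (suc n) (exp-term η) + Σ< n (exp-term η) ^ q) + (θ * exp-term η (suc n) + exp-term η n ^ q)
      ≈⟨ solve 5 (λ θ a b c d → (θ :* a :+ b) :+ (θ :* c :+ d) := θ :* (a :+ c) :+ (b :+ d)) refl θ _ _ _ _ ⟩
    θ * (Σ< (suc n) (exp-term η) + exp-term η (suc n)) + (Σ< n (exp-term η) ^ q + exp-term η n ^ q)
      ≈⟨ +-cong (*-congˡ (sym (Σ<-suc (suc n) (exp-term η)))) (trans (sym (frobenius-+ _ _)) (^-congˡ q (sym (Σ<-suc n (exp-term η))))) ⟩
    θ * Σ< (suc (suc n)) (exp-term η) + Σ< (suc n) (exp-term η) ^ q ∎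

  ⇢-θ* : ∀ {u l} → u ⇢ l → (λ n → θ * u n) ⇢ (θ * l)
  ⇢-θ* u⇢l n = let N , s = u⇢l (suc n) in N , λ m N≤m → S-cong (x[y-z]≈xy-xz θ _ _) (S-θ* deg-θ (s m N≤m))

  exp-θ* : ∀ {η y} → IsCarlitzExp η y → IsCarlitzExp (θ * η) (θ * y + y ^ q)
  exp-θ* {η} y-exp = ⇢⇒⟶ (⇢-unsuc (⇢-cong (λ n → sym (exp-sum-θ* η n)) (⇢-+ (⇢-θ* (⇢-suc E⇢y)) (⇢-^q E⇢y))))
    where E⇢y = ⟶⇒⇢ y-exp

  -- The functional equation of the Carlitz module. The argument η′ is separate because the points
  -- π̃/θ^(i+1) are related by θ only up to `_≈_`.
  exp-functional : ∀ {η η′ y y′} → IsCarlitzExp η y → IsCarlitzExp η′ y′ → θ * η ≈ η′ → θ * y + y ^ q ≈ y′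
  exp-functional y-exp y′-exp eq = ⇢-unique
    (⇢-cong (λ n → Σ<-cong n (λ i → exp-term-cong i eq)) (⟶⇒⇢ (exp-θ* y-exp))) (⟶⇒⇢ y′-exp)

-- The period, the coefficients of s_Car and the values of its twist

module Period {c ℓ} {q : ℕ} (T : CarlitzTower c ℓ q)
              {π̃ : Carlitz.Carrier T} (period : Carlitz.IsFundamentalPeriod T π̃) where
  open Carlitz T using (𝔽q; ι; θ; bracket; IsCarlitzExp; IsSCar; HasValueAt; τ)
  open ValuedField (CarlitzTower.ℂ∞ T) using (underlying)
  open FieldProperties underlying
  open Valuation (CarlitzTower.ℂ∞ T)
  open Tower T
  open FiniteField (CarlitzTower.𝔽q T) (CarlitzTower.𝔽q-card T) using (2≤q)
  open FiniteFieldExtension (CarlitzTower.𝔽q T) (CarlitzTower.𝔽q-card T) underlying ι ι-hom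
  open Carlitz.IsFundamentalPeriod period
  open import Relation.Binary.Reasoning.Setoid setoid

  private
    q∸1 : ∃[ m ] q ℕ.∸ 1 ≡ suc m
    q∸1 = _ , ≡.sym (ℕ.suc-pred (q ℕ.∸ 1) {{ℕ.>-nonZero (ℕ.m<n⇒0<n∸m 2≤q)}})

    m = proj₁ q∸1

    root^[1+m] : root ^ suc m ≈ - θ
    root^[1+m] = trans (^-congʳ root (≡.sym (proj₂ q∸1))) isRoot

  -θ≉0 : ¬ - θ ≈ 0#
  -θ≉0 eq = θ≉0 (trans (sym (-‿involutive θ)) (trans (-‿cong eq) -0#≈0#))

  root≉0 : ¬ root ≈ 0#
  root≉0 eq = -θ≉0 (trans (sym root^[1+m]) (trans (*-congʳ eq) (zeroˡ _)))

  -- The (q-1)-th power of λ/θ is -θ^(2-q), which is at most 1 in absolute value as q ≥ 2.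
  S-root/θ : Small 0 (root * θ ⁻¹)
  S-root/θ = S-root m (S-cong (sym (begin
    (root * θ ⁻¹) ^ suc m               ≈⟨ ^-distrib-* root (θ ⁻¹) (suc m) ⟩
    root ^ suc m * (θ ⁻¹ * (θ ⁻¹) ^ m)  ≈⟨ *-congʳ root^[1+m] ⟩
    - θ * (θ ⁻¹ * (θ ⁻¹) ^ m)           ≈⟨ solve 3 (λ θ i p → :- θ :* (i :* p) := :- (θ :* i :* p)) refl θ _ _ ⟩
    - (θ * θ ⁻¹ * (θ ⁻¹) ^ m)           ≈⟨ -‿cong (trans (*-congʳ (inverseʳ θ≉0)) (*-identityˡ _)) ⟩
    - ((θ ⁻¹) ^ m)                      ∎))
    (S-neg (S-^₀ m (S-mono z≤n (S-θ⁻¹ deg-θ)))))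

  S-root⁻¹ : Small 0 (root ⁻¹)
  S-root⁻¹ = S-root m (S-cong (sym (begin
    (root ⁻¹) ^ suc m   ≈⟨ ^-⁻¹ (suc m) root≉0 ⟩
    (root ^ suc m) ⁻¹   ≈⟨ ⁻¹-cong root^[1+m] ⟩
    (- θ) ⁻¹            ≈⟨ ⁻¹-unique (trans (solve 2 (λ θ i → :- θ :* :- i := θ :* i) refl θ _) (inverseʳ θ≉0)) ⟨
    - (θ ⁻¹)            ∎))
    (S-neg (S-mono z≤n (S-θ⁻¹ deg-θ))))

  R : ℕ → Carrier
  R n = ∏< n (λ i → (1# - u[ i ]) ⁻¹)

  R⇢prod : R ⇢ prod
  R⇢prod = ⟶⇒⇢ isProd

  S-R : ∀ n → Small 0 (R n)
  S-R zero    = S-1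
  S-R (suc n) = S-cong (sym (∏<-suc n (λ i → (1# - u[ i ]) ⁻¹))) (S-*₀ (S-R n) (S-[1-u]⁻¹ (S-u[] n)))

  S-R-1 : ∀ n → Small 1 (R n - 1#)
  S-R-1 zero    = S-cong (sym (-‿inverseʳ 1#)) (S-0 1)
  S-R-1 (suc n) = S-cong (begin
    (R n - 1#) * v + u[ n ] * v             ≈⟨ solve 3 (λ r u v → (r :- con 1ℤ) :* v :+ u :* v := r :* v :- (con 1ℤ :- u) :* v) refl (R n) u[ n ] v ⟩
    R n * v - (1# - u[ n ]) * v             ≈⟨ +-cong (sym (∏<-suc n (λ i → (1# - u[ i ]) ⁻¹))) (-‿cong (inverseʳ (S-1-u-nonzero (S-u[] n)))) ⟩
    R (suc n) - 1#                          ∎)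
    (S-+ (S-*₀ʳ (S-R-1 n) Sv) (S-*₀ʳ (S-u[] n) Sv))
    where
    v = (1# - u[ n ]) ⁻¹
    Sv = S-[1-u]⁻¹ (S-u[] n)

  S-prod-1 : Small 1 (prod - 1#)
  S-prod-1 = ⇢-limit-S 0 (λ n _ → S-R-1 n) R⇢prod

  S-prod : Small 0 prod
  S-prod = S-cong (solve 1 (λ x → x :- con 1ℤ :+ con 1ℤ := x) refl prod) (S-+ (S-mono z≤n S-prod-1) S-1)

  η : ℕ → Carrier
  η i = π̃ / θ ^ suc i

  θ*η-suc : ∀ i → θ * η (suc i) ≈ η i
  θ*η-suc i = begin
    θ * (π̃ * (θ * θ ^ suc i) ⁻¹)       ≈⟨ *-congˡ (*-congˡ (⁻¹-distrib-* θ≉0 (θ^≉0 (suc i)))) ⟩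
    θ * (π̃ * (θ ⁻¹ * (θ ^ suc i) ⁻¹))  ≈⟨ solve 4 (λ θ p i j → θ :* (p :* (i :* j)) := θ :* i :* (p :* j)) refl θ π̃ _ _ ⟩
    θ * θ ⁻¹ * η i                     ≈⟨ trans (*-congʳ (inverseʳ θ≉0)) (*-identityˡ _) ⟩
    η i                                ∎

  η-suc : ∀ i → η (suc i) ≈ θ ⁻¹ * η i
  η-suc i = *-cancelˡ-nonzero θ≉0 (trans (θ*η-suc i) (sym
    (trans (sym (*-assoc _ _ _)) (trans (*-congʳ (inverseʳ θ≉0)) (*-identityˡ _)))))

  θ*η-zero : θ * η 0 ≈ π̃
  θ*η-zero = begin
    θ * (π̃ * (θ * 1#) ⁻¹)   ≈⟨ *-congˡ (*-congˡ (⁻¹-cong (*-identityʳ θ))) ⟩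
    θ * (π̃ * θ ⁻¹)          ≈⟨ solve 3 (λ θ p i → θ :* (p :* i) := p :* (θ :* i)) refl θ π̃ _ ⟩
    π̃ * (θ * θ ⁻¹)          ≈⟨ trans (*-congˡ (inverseʳ θ≉0)) (*-identityʳ π̃) ⟩
    π̃                       ∎

  η-zero : η 0 ≈ root * prod
  η-zero = *-cancelˡ-nonzero θ≉0 (trans θ*η-zero (trans formula (*-assoc _ _ _)))

  S-η-zero/θ : Small 0 (η 0 * θ ⁻¹)
  S-η-zero/θ = S-cong
    (trans (solve 3 (λ r i p → r :* i :* p := r :* p :* i) refl root _ prod) (*-congʳ (sym η-zero)))
    (S-*₀ S-root/θ S-prod)

  -- Index 0 is kept apart: |η 0| = q^(1/(q-1)) exceeds 1, and only η_0/θ is bounded.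
  S-η-suc : ∀ i → Small i (η (suc i))
  S-η-suc zero    = S-cong (trans (*-comm _ _) (sym (η-suc 0))) S-η-zero/θ
  S-η-suc (suc i) = S-cong (sym (η-suc (suc i))) (S-* {1} (S-θ⁻¹ deg-θ) (S-η-suc i))

  S-exp-term-suc : ∀ {n} y k → Small n (exp-term y k) → Small (suc n) (exp-term y (suc k))
  S-exp-term-suc y k s = S-cong (sym (trans (exp-term-suc y k) (*-comm _ _))) (S-* {1} (S-bracket⁻¹ k) (S-^q s))

  S-exp-term-η-suc : ∀ i n → Small (n ℕ.+ i) (exp-term (η (suc i)) n)
  S-exp-term-η-suc i zero    = S-cong (sym (exp-term-zero _)) (S-η-suc i)
  S-exp-term-η-suc i (suc n) = S-exp-term-suc (η (suc i)) n (S-exp-term-η-suc i n)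

  S-exp-term-η-zero : ∀ n → Small n (exp-term (η 0) (suc n))
  S-exp-term-η-zero (suc n) = S-exp-term-suc (η 0) (suc n) (S-exp-term-η-zero n)
  -- The first correction η_0^q/[1] is (η_0/θ)^q times θ^q/[1], and both factors have absolute value
  -- at most 1.
  S-exp-term-η-zero zero = S-cong (sym (begin
    exp-term (η 0) 1
      ≈⟨ trans (exp-term-suc (η 0) 0) (*-congʳ (^-congˡ q (exp-term-zero _))) ⟩
    η 0 ^ q * bracket 1 ⁻¹
      ≈⟨ *-congʳ (^-congˡ q (trans (sym (*-identityʳ _)) (trans (*-congˡ (sym (inverseˡ θ≉0))) (sym (*-assoc _ _ _))))) ⟩
    (η 0 * θ ⁻¹ * θ) ^ q * bracket 1 ⁻¹
      ≈⟨ trans (*-congʳ (^-distrib-* _ θ q)) (*-assoc _ _ _) ⟩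
    (η 0 * θ ⁻¹) ^ q * (θ ^ q * bracket 1 ⁻¹)
      ≈⟨ *-congˡ (trans (*-congʳ (^-congʳ θ (≡.sym (ℕ.*-identityʳ q)))) (θ[]*bracket⁻¹ 0)) ⟩
    (η 0 * θ ⁻¹) ^ q * (1# - u[ 0 ]) ⁻¹ ∎))
    (S-*₀ (S-^q S-η-zero/θ) (S-[1-u]⁻¹ (S-u[] 0)))

  s-zero : ∃[ s ] IsCarlitzExp (η 0) s × Small 0 (s - exp-term (η 0) 0)
  s-zero = series-converges ℂ∞-complete 0 (exp-term (η 0)) S-exp-term-η-zero

  s-suc : ∀ i → ∃[ s ] IsCarlitzExp (η (suc i)) s × Small i (s - exp-term (η (suc i)) 0)
  s-suc i = series-converges ℂ∞-complete i (exp-term (η (suc i)))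
    (λ n → S-mono (ℕ.m≤n⇒m≤1+n (ℕ.≤-reflexive (ℕ.+-comm i n))) (S-exp-term-η-suc i (suc n)))

  s : ℕ → Carrier
  s zero    = proj₁ s-zero
  s (suc i) = proj₁ (s-suc i)

  isSCar : IsSCar π̃ s
  isSCar zero    = proj₁ (proj₂ s-zero)
  isSCar (suc i) = proj₁ (proj₂ (s-suc i))

  -- The exponential series gives s_0 = η_0 up to the unit disc. Further, η_0 = λ `prod`, and |λ
  -- (`prod` - 1)| ≤ q · q^(-1).
  S-s-zero : Small 0 (s 0 - root)
  S-s-zero = S-cong
    (solve 3 (λ s e r → (s :- e) :+ (e :- r) := s :- r) refl (s 0) (exp-term (η 0) 0) root)
    (S-+ (proj₂ (proj₂ s-zero)) (S-cong (begin
      (root * θ ⁻¹) * (θ * (prod - 1#))      ≈⟨ solve 4 (λ r i θ p → (r :* i) :* (θ :* (p :- con 1ℤ)) := r :* (i :* θ) :* (p :- con 1ℤ)) refl root _ θ prod ⟩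
      root * (θ ⁻¹ * θ) * (prod - 1#)        ≈⟨ *-congʳ (trans (*-congˡ (inverseˡ θ≉0)) (*-identityʳ root)) ⟩
      root * (prod - 1#)                     ≈⟨ solve 2 (λ r p → r :* (p :- con 1ℤ) := r :* p :- r) refl root prod ⟩
      root * prod - root                     ≈⟨ +-congʳ (trans (exp-term-zero _) η-zero) ⟨
      exp-term (η 0) 0 - root                ∎)
      (S-*₀ S-root/θ (S-θ* deg-θ S-prod-1))))

  S-s-suc : ∀ i → Small i (s (suc i))
  S-s-suc i = S-cong (solve 2 (λ s e → (s :- e) :+ e := s) refl _ _)
    (S-+ (proj₂ (proj₂ (s-suc i))) (S-exp-term-η-suc i 0))

  -- The convention s_(-1) = 0 is the value e_Car(π̃).
  s[_-1] : ℕ → Carrier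
  s[ zero  -1] = 0#
  s[ suc i -1] = s i

  exp-π̃ : IsCarlitzExp π̃ 0#
  exp-π̃ = Equivalence.from (kernel π̃) (monic 𝔽q [] , sym (trans (*-congʳ
    (trans (+-cong (IsRingHomomorphism.1#-homo ι-hom) (zeroʳ θ)) (+-identityʳ 1#))) (*-identityˡ π̃)))

  -- Coefficientwise τ s_Car = (t - θ) s_Car, from the functional equation at π̃/θ^(i+1).
  s^q : ∀ i → s i ^ q ≈ s[ i -1] - θ * s i
  s^q i = trans (solve 2 (λ a b → a := (b :+ a) :- b) refl (s i ^ q) (θ * s i)) (+-congʳ (relation i))
    where
    relation : ∀ i → θ * s i + s i ^ q ≈ s[ i -1]
    relation zero    = exp-functional (isSCar 0) exp-π̃ θ*η-zero
    relation (suc i) = exp-functional (isSCar (suc i)) (isSCar i) (θ*η-suc i)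

  τs-term : Carrier → ℕ → Carrier
  τs-term x i = s i ^ q * x ^ i

  τs-value : ∀ {x} → Small 0 x → ∃[ y ] HasValueAt (τ s) x y × Small 0 (y - s 0 ^ q * 1#)
  τs-value {x} sx = series-converges ℂ∞-complete 0 (τs-term x)
    (λ i → S-*₀ʳ (S-^q (S-s-suc i)) (S-^₀ (suc i) sx))

  τs-term^q : ∀ x i → τs-term x i ^ q ≈ s[ i -1] ^ q * (x ^ q) ^ i - θ ^ q * τs-term (x ^ q) i
  τs-term^q x i = begin
    (s i ^ q * x ^ i) ^ q                  ≈⟨ ^-distrib-* _ _ q ⟩
    (s i ^ q) ^ q * (x ^ i) ^ q            ≈⟨ *-cong (trans (^-congˡ q (s^q i)) (frobenius-- _ _)) (trans (^-assocʳ x i q) (trans (^-congʳ x (ℕ.*-comm i q)) (sym (^-assocʳ x q i)))) ⟩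
    (s[ i -1] ^ q - (θ * s i) ^ q) * X ^ i ≈⟨ *-congʳ (+-congˡ (-‿cong (^-distrib-* θ (s i) q))) ⟩
    (s[ i -1] ^ q - θ ^ q * s i ^ q) * X ^ i ≈⟨ solve 4 (λ p t s x → (p :- t :* s) :* x := p :* x :- t :* (s :* x)) refl _ _ _ _ ⟩
    s[ i -1] ^ q * X ^ i - θ ^ q * τs-term X i ∎
    where X = x ^ q

  -- Applying Frobenius to `s^q` gives (s_i^q)^q = s_(i-1)^q - θ^q s_i^q; the shifted index costs
  -- the first sum on the right one term.
  τs-partial^q : ∀ x n → Σ< (suc n) (τs-term x) ^ q ≈
                 x ^ q * Σ< n (τs-term (x ^ q)) - θ ^ q * Σ< (suc n) (τs-term (x ^ q))
  τs-partial^q x zero = begin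
    (τs-term x 0 + 0#) ^ q                            ≈⟨ ^-congˡ q (+-identityʳ _) ⟩
    τs-term x 0 ^ q                                   ≈⟨ τs-term^q x 0 ⟩
    0# ^ q * 1# - θ ^ q * τs-term X 0                 ≈⟨ +-congʳ (*-congʳ 0^q≈0) ⟩
    0# * 1# - θ ^ q * τs-term X 0                     ≈⟨ solve 3 (λ x t u → con 0ℤ :* con 1ℤ :- t :* u := x :* con 0ℤ :- t :* (u :+ con 0ℤ)) refl X (θ ^ q) _ ⟩
    X * 0# - θ ^ q * (τs-term X 0 + 0#)               ∎
    where X = x ^ q
  τs-partial^q x (suc n) = begin
    Σ< (suc (suc n)) (τs-term x) ^ q
      ≈⟨ trans (^-congˡ q (Σ<-suc (suc n) (τs-term x))) (frobenius-+ _ _) ⟩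
    Σ< (suc n) (τs-term x) ^ q + τs-term x (suc n) ^ q
      ≈⟨ +-cong (τs-partial^q x n) (τs-term^q x (suc n)) ⟩
    (X * Σ< n (τs-term X) - θ ^ q * Σ< (suc n) (τs-term X)) + (s n ^ q * (X * X ^ n) - θ ^ q * τs-term X (suc n))
      ≈⟨ solve 7 (λ x a t b s p c → (x :* a :- t :* b) :+ (s :* (x :* p) :- t :* c) := x :* (a :+ s :* p) :- t :* (b :+ c)) refl X _ (θ ^ q) _ _ _ _ ⟩
    X * (Σ< n (τs-term X) + τs-term X n) - θ ^ q * (Σ< (suc n) (τs-term X) + τs-term X (suc n))
      ≈⟨ +-cong (*-congˡ (Σ<-suc n (τs-term X))) (-‿cong (*-congˡ (Σ<-suc (suc n) (τs-term X)))) ⟨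
    X * Σ< (suc n) (τs-term X) - θ ^ q * Σ< (suc (suc n)) (τs-term X) ∎
    where X = x ^ q

  τs-value-cong : ∀ {x x′ y} → x ≈ x′ → HasValueAt (τ s) x y → HasValueAt (τ s) x′ y
  τs-value-cong eq h = ⇢⇒⟶ (⇢-cong (λ n → Σ<-cong n (λ i → *-congˡ {s i ^ q} (^-congˡ i eq))) (⟶⇒⇢ h))

  τs-value^q : ∀ {x y z} → Small 0 x → HasValueAt (τ s) x y → HasValueAt (τ s) (x ^ q) z →
               y ^ q ≈ (x ^ q - θ ^ q) * z
  τs-value^q {x} {y} {z} sx hy hz = ⇢-unique (⇢-^q (⇢-suc (⟶⇒⇢ hy))) limit
    where
    Z⇢z = ⟶⇒⇢ hz
    limit : (λ n → Σ< (suc n) (τs-term x) ^ q) ⇢ ((x ^ q - θ ^ q) * z)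
    limit k =
      -- Multiplication by θ^q loses q units of precision, hence the threshold q + k.
      let N , s₁ = Z⇢z k ; N′ , s₂ = ⇢-suc Z⇢z (q ℕ.+ k) in
      N ℕ.+ N′ , λ n N+N′≤n → S-cong
        (trans (solve 5 (λ x a t b z → x :* (a :- z) :- t :* (b :- z) := x :* a :- t :* b :- (x :- t) :* z) refl (x ^ q) _ (θ ^ q) _ z)
          (+-congʳ (sym (τs-partial^q x n))))
        (S-- (S-*₀ (S-^q sx) (s₁ n (ℕ.m+n≤o⇒m≤o N N+N′≤n)))
             (S-θ^* deg-θ q (s₂ n (ℕ.m+n≤o⇒n≤o N N+N′≤n))))

  -- The descending order makes `∏θ x (suc n)` unfold to its new factor times `∏θ x n`.
  ∏θ : Carrier → ℕ → Carrier
  ∏θ x n = ∏< n (λ i → x - θ ^ (q ℕ.^ (n ℕ.∸ i)))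

  ∏θ-cong : ∀ {x x′} n → x ≈ x′ → ∏θ x n ≈ ∏θ x′ n
  ∏θ-cong n eq = ∏<-cong n (λ i → +-cong eq (refl { - (θ ^ (q ℕ.^ (n ℕ.∸ i)))}))

  -- Each application moves the evaluation point from x to x^q; the factor x^q - θ^q, raised to q^n,
  -- becomes the top factor of the product.
  τs-value^q^ : ∀ n {x y z} → Small 0 x → HasValueAt (τ s) x y → HasValueAt (τ s) (x ^ (q ℕ.^ n)) z →
                y ^ (q ℕ.^ n) ≈ ∏θ (x ^ (q ℕ.^ n)) n * z
  τs-value^q^ zero {x} {y} {z} sx hy hz = trans (*-identityʳ y) (trans
    (⇢-unique (⟶⇒⇢ hy) (⟶⇒⇢ (τs-value-cong (*-identityʳ x) hz))) (sym (*-identityˡ z)))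
  τs-value^q^ (suc n) {x} {y} {z} sx hy hz = begin
    y ^ (q ℕ.* q ℕ.^ n)                       ≈⟨ ^-assocʳ y q (q ℕ.^ n) ⟨
    (y ^ q) ^ (q ℕ.^ n)                       ≈⟨ ^-congˡ (q ℕ.^ n) (τs-value^q sx hy hy′) ⟩
    ((x ^ q - θ ^ q) * y′) ^ (q ℕ.^ n)        ≈⟨ ^-distrib-* _ y′ (q ℕ.^ n) ⟩
    (x ^ q - θ ^ q) ^ (q ℕ.^ n) * y′ ^ (q ℕ.^ n)
      ≈⟨ *-cong (frobenius-iterate n _ _) (τs-value^q^ n (S-^q sx) hy′ (τs-value-cong (sym (^-assocʳ x q (q ℕ.^ n))) hz)) ⟩
    ((x ^ q) ^ (q ℕ.^ n) - (θ ^ q) ^ (q ℕ.^ n)) * (∏θ ((x ^ q) ^ (q ℕ.^ n)) n * z)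
      ≈⟨ *-cong (+-cong (^-assocʳ x q (q ℕ.^ n)) (-‿cong (^-assocʳ θ q (q ℕ.^ n)))) (*-congʳ (∏θ-cong n (^-assocʳ x q (q ℕ.^ n)))) ⟩
    (x ^ (q ℕ.^ suc n) - θ ^ (q ℕ.^ suc n)) * (∏θ (x ^ (q ℕ.^ suc n)) n * z)
      ≈⟨ *-assoc _ _ _ ⟨
    ∏θ (x ^ (q ℕ.^ suc n)) (suc n) * z        ∎
    where
    y′ = proj₁ (τs-value (S-^q sx))
    hy′ = proj₁ (proj₂ (τs-value (S-^q sx)))

  σ : Carrier
  σ = root ^ q

  -- Hence π̃ = θ λ `prod` = -σ `prod`, the source of the sign in the value of L.
  σ≈-θroot : σ ≈ - (θ * root)
  σ≈-θroot = begin
    root ^ q               ≈⟨ ^-congʳ root (≡.trans (≡.cong suc (≡.sym (proj₂ q∸1))) (ℕ.m+[n∸m]≡n (ℕ.≤-trans (s≤s z≤n) 2≤q))) ⟨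
    root * root ^ suc m    ≈⟨ *-congˡ root^[1+m] ⟩
    root * - θ             ≈⟨ solve 2 (λ r θ → r :* :- θ := :- (θ :* r)) refl root θ ⟩
    - (θ * root)           ∎

  σ≉0 : ¬ σ ≈ 0#
  σ≉0 = ^-nonzero q root≉0

  S-σ⁻¹ : Small 1 (σ ⁻¹)
  S-σ⁻¹ = S-cong (⁻¹-unique (begin
    σ * - (θ ⁻¹ * root ⁻¹)                  ≈⟨ *-congʳ σ≈-θroot ⟩
    - (θ * root) * - (θ ⁻¹ * root ⁻¹)       ≈⟨ solve 4 (λ a b c d → :- (a :* b) :* :- (c :* d) := a :* c :* (b :* d)) refl θ root _ _ ⟩
    θ * θ ⁻¹ * (root * root ⁻¹)             ≈⟨ *-cong (inverseʳ θ≉0) (inverseʳ root≉0) ⟩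
    1# * 1#                                 ≈⟨ *-identityˡ 1# ⟩
    1#                                      ∎))
    (S-neg (S-*₀ʳ (S-θ⁻¹ deg-θ) S-root⁻¹))

-- The value L(χ_ξ, 1)

module LValue {c ℓ} {q : ℕ} (T : CarlitzTower c ℓ q)
              {π̃ : Carlitz.Carrier T} (period : Carlitz.IsFundamentalPeriod T π̃)
              {ξ : Carlitz.Carrier T} {r : ℕ} (0<r : 0 ℕ.< r)
              (ξ^q^r≈ξ : Carlitz._≈_ T (Carlitz._^_ T ξ (q ℕ.^ r)) ξ) where
  open Carlitz T using (𝔽q; ι; θ; bracket; IsSCar; HasValueAt; τ; IsLValue)
  open ValuedField (CarlitzTower.ℂ∞ T) using (underlying)
  open FieldProperties underlying
  open Valuation (CarlitzTower.ℂ∞ T)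
  open Tower T
  open Period T period
  private
    module 𝔽 = FieldProperties (CarlitzTower.𝔽q T)
  open FiniteField (CarlitzTower.𝔽q T) (CarlitzTower.𝔽q-card T) using (2≤q)
  open FiniteFieldExtension (CarlitzTower.𝔽q T) (CarlitzTower.𝔽q-card T) underlying ι ι-hom
  open CarlitzSums (CarlitzTower.𝔽q T) (CarlitzTower.𝔽q-card T) underlying ι ι-hom θ ξ θ-aperiodic θ-transcendental
    using (term; ∏-ratio; ∑-words≤)
  open Words (CarlitzTower.𝔽q T) (CarlitzTower.𝔽q-card T) using (words≤; words≤!; ∈-words≤)
  open Carlitz.IsFundamentalPeriod period
  open import Relation.Binary.Reasoning.Setoid setoid

  S-ξ : Small 0 ξ
  S-ξ = x^m≈x⇒S (2≤ r 0<r) ξ^q^r≈ξ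
    where
    2≤ : ∀ r → 0 ℕ.< r → 2 ℕ.≤ q ℕ.^ r
    2≤ (suc k) _ = 2≤q^[1+k] k

  ξ^q^[rm]≈ξ : ∀ m → ξ ^ (q ℕ.^ (r ℕ.* m)) ≈ ξ
  ξ^q^[rm]≈ξ m = trans (^-congʳ ξ (≡.sym (ℕ.^-*-assoc q r m))) (go m)
    where
    go : ∀ m → ξ ^ ((q ℕ.^ r) ℕ.^ m) ≈ ξ
    go zero    = *-identityʳ ξ
    go (suc m) = trans (sym (^-assocʳ ξ (q ℕ.^ r) _)) (trans (^-congˡ ((q ℕ.^ r) ℕ.^ m) ξ^q^r≈ξ) (go m))

  ρ : Carrier
  ρ = proj₁ (τs-value S-ξ)

  ρ-value : HasValueAt (τ s) ξ ρ
  ρ-value = proj₁ (proj₂ (τs-value S-ξ))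

  ρ^q^n : ∀ n → ξ ^ (q ℕ.^ n) ≈ ξ → ρ ^ (q ℕ.^ n) ≈ ∏θ ξ n * ρ
  ρ^q^n n eq = trans (τs-value^q^ n S-ξ ρ-value (τs-value-cong (sym eq) ρ-value)) (*-congʳ (∏θ-cong n eq))

  -- Up to the unit disc ρ is its first term s_0^q, and s_0^q - λ^q = (s_0 - λ)^q.
  S-ρ-σ : Small 0 (ρ - σ)
  S-ρ-σ = S-cong
    (trans (+-congˡ (frobenius-- (s 0) root)) (solve 3 (λ ρ s r → (ρ :- s :* con 1ℤ) :+ (s :- r) := ρ :- r) refl ρ (s 0 ^ q) σ))
    (S-+ (proj₂ (proj₂ (τs-value S-ξ))) (S-^q S-s-zero))

  -- Otherwise `S-ρ-σ` would give |σ| ≤ 1, against |σ⁻¹| ≤ q^(-1).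
  ρ≉0 : ¬ ρ ≈ 0#
  ρ≉0 ρ≈0 = ¬S-1 (S-cong (begin
    - (ρ - σ) * σ ⁻¹    ≈⟨ *-congʳ (-‿cong (+-congʳ ρ≈0)) ⟩
    - (0# - σ) * σ ⁻¹   ≈⟨ solve 2 (λ σ i → :- (con 0ℤ :- σ) :* i := σ :* i) refl σ _ ⟩
    σ * σ ⁻¹            ≈⟨ inverseʳ σ≉0 ⟩
    1#                  ∎)
    (S-*₀ (S-neg S-ρ-σ) S-σ⁻¹))

  ρ-equation : ρ ^ (q ℕ.^ r ℕ.∸ 1) ≈ ∏θ ξ r
  ρ-equation = *-cancelˡ-nonzero ρ≉0 (begin
    ρ ^ suc (q ℕ.^ r ℕ.∸ 1)   ≡⟨ ≡.cong (ρ ^_) (ℕ.m+[n∸m]≡n (ℕ.m^n>0 q {{ℕ.>-nonZero (ℕ.≤-trans (s≤s z≤n) 2≤q)}} r)) ⟩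
    ρ ^ (q ℕ.^ r)             ≈⟨ ρ^q^n r ξ^q^r≈ξ ⟩
    ∏θ ξ r * ρ                ≈⟨ *-comm _ _ ⟩
    ρ * ∏θ ξ r                ∎)

  w : Carrier
  w = ρ * σ ⁻¹

  w⁻¹ : Carrier
  w⁻¹ = σ * ρ ⁻¹

  w*w⁻¹ : w * w⁻¹ ≈ 1#
  w*w⁻¹ = trans (solve 4 (λ a b c d → a :* b :* (c :* d) := c :* b :* (a :* d)) refl ρ _ σ _)
    (trans (*-cong (inverseʳ σ≉0) (inverseʳ ρ≉0)) (*-identityˡ 1#))

  S-w-1 : Small 1 (w - 1#)
  S-w-1 = S-cong (trans ([y-z]x≈yx-zx _ _ _) (+-congˡ (-‿cong (inverseʳ σ≉0)))) (S-*₀ S-ρ-σ S-σ⁻¹)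

  S-w⁻¹ : Small 0 w⁻¹
  S-w⁻¹ = S-cong (sym (trans (⁻¹-unique w*w⁻¹) (⁻¹-cong (solve 1 (λ w → w := con 1ℤ :- (con 1ℤ :- w)) refl w))))
    (S-[1-u]⁻¹ (S-cong (solve 1 (λ w → :- (w :- con 1ℤ) := con 1ℤ :- w) refl w) (S-neg S-w-1)))

  n<q^n : ∀ n → n ℕ.< q ℕ.^ n
  n<q^n zero    = s≤s z≤n
  n<q^n (suc n) = ℕ.≤-trans (ℕ.≤-trans (s≤s (ℕ.≤-trans (n<q^n n) (ℕ.m≤m+n _ 0)))
    (ℕ.+-monoˡ-≤ _ (ℕ.≤-trans (s≤s z≤n) (n<q^n n)))) (ℕ.*-monoˡ-≤ (q ℕ.^ n) 2≤q)

  -- Frobenius gives w^(q^n) - 1 = (w - 1)^(q^n), and q^n > n.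
  S-w^q^n-1 : ∀ n → Small n (w ^ (q ℕ.^ n) - 1#)
  S-w^q^n-1 n = S-cong (trans (frobenius-iterate n w 1#) (+-congˡ (-‿cong (1^n≈1 (q ℕ.^ n)))))
    (S-mono (ℕ.<⇒≤ (n<q^n n)) (S-^ (q ℕ.^ n) S-w-1))

  σ^q^[1+n] : ∀ n → σ ^ (q ℕ.^ suc n) ≈ σ ^ (q ℕ.^ n) * - (θ ^ (q ℕ.^ suc n))
  σ^q^[1+n] n = begin
    σ ^ N                            ≈⟨ ^-congˡ N σ≈-θroot ⟩
    -- The factor -θ is written as 0 - θ so that `frobenius-iterate` treats its sign for every q.
    (- (θ * root)) ^ N               ≈⟨ ^-congˡ N (solve 2 (λ θ r → :- (θ :* r) := r :* (con 0ℤ :- θ)) refl θ root) ⟩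
    (root * (0# - θ)) ^ N            ≈⟨ ^-distrib-* root (0# - θ) N ⟩
    root ^ N * (0# - θ) ^ N          ≈⟨ *-cong (sym (^-assocʳ root q (q ℕ.^ n))) (frobenius-iterate (suc n) 0# θ) ⟩
    σ ^ (q ℕ.^ n) * (0# ^ N - θ ^ N) ≈⟨ *-congˡ (+-congʳ 0^N≈0) ⟩
    σ ^ (q ℕ.^ n) * (0# - θ ^ N)     ≈⟨ *-congˡ (+-identityˡ _) ⟩
    σ ^ (q ℕ.^ n) * - (θ ^ N)        ∎
    where
    N = q ℕ.^ suc n
    0^N≈0 : 0# ^ N ≈ 0#
    0^N≈0 = trans (sym (^[q^n]^q 0# n)) (go n)
      where
      go : ∀ n → (0# ^ (q ℕ.^ n)) ^ q ≈ 0#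
      go zero    = trans (^-congˡ q (*-identityʳ 0#)) 0^q≈0
      go (suc n) = trans (^-congˡ q (trans (sym (^[q^n]^q 0# n)) (go n))) 0^q≈0

  -- Raising n by one multiplies σ^(q^n) by -θ_(n+1), and -θ_(n+1)/(θ - θ_(n+1)) = (1 - θ/θ_(n+1))⁻¹
  -- is the next factor of the period product.
  ∏-ratio*σ^q^n : ∀ n → ∏-ratio n * σ ^ (q ℕ.^ n) ≈ ∏θ ξ n * σ * R n
  ∏-ratio*σ^q^n zero    = solve 1 (λ s → con 1ℤ :* (s :* con 1ℤ) := con 1ℤ :* s :* con 1ℤ) refl σ
  ∏-ratio*σ^q^n (suc n) = begin
    (ξ - p) * (θ - p) ⁻¹ * ∏-ratio n * σ ^ (q ℕ.^ suc n)
      ≈⟨ *-congˡ (σ^q^[1+n] n) ⟩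
    (ξ - p) * (θ - p) ⁻¹ * ∏-ratio n * (σ ^ (q ℕ.^ n) * - p)
      ≈⟨ solve 5 (λ x i a s p → x :* i :* a :* (s :* :- p) := x :* (a :* s) :* (p :* :- i)) refl (ξ - p) ((θ - p) ⁻¹) (∏-ratio n) _ p ⟩
    (ξ - p) * (∏-ratio n * σ ^ (q ℕ.^ n)) * (p * - ((θ - p) ⁻¹))
      ≈⟨ *-cong (*-congˡ (∏-ratio*σ^q^n n)) (trans (*-congˡ -[θ-p]⁻¹) (θ[]*bracket⁻¹ n)) ⟩
    (ξ - p) * (∏θ ξ n * σ * R n) * (1# - u[ n ]) ⁻¹
      ≈⟨ solve 5 (λ x m s r v → x :* (m :* s :* r) :* v := x :* m :* s :* (r :* v)) refl (ξ - p) (∏θ ξ n) σ (R n) _ ⟩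
    (ξ - p) * ∏θ ξ n * σ * (R n * (1# - u[ n ]) ⁻¹)
      ≈⟨ *-congˡ (∏<-suc n (λ i → (1# - u[ i ]) ⁻¹)) ⟨
    ∏θ ξ (suc n) * σ * R (suc n) ∎
    where
    p = θ ^ (q ℕ.^ suc n)
    θ-p≉0 : ¬ θ - p ≈ 0#
    θ-p≉0 eq = bracket-nonzero n (trans (solve 2 (λ p θ → p :- θ := :- (θ :- p)) refl p θ) (trans (-‿cong eq) -0#≈0#))
    -[θ-p]⁻¹ : - ((θ - p) ⁻¹) ≈ bracket (suc n) ⁻¹
    -[θ-p]⁻¹ = ⁻¹-unique (trans (solve 3 (λ p θ i → (p :- θ) :* :- i := (θ :- p) :* i) refl p θ _) (inverseʳ θ-p≉0))

  ∏-ratio≈ : ∀ n → ξ ^ (q ℕ.^ n) ≈ ξ → ∏-ratio n ≈ w⁻¹ * (w ^ (q ℕ.^ n) * R n)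
  ∏-ratio≈ n eq = *-cancelˡ-nonzero (*-nonzero (^-nonzero N σ≉0) ρ≉0) (begin
    σ ^ N * ρ * ∏-ratio n                    ≈⟨ solve 3 (λ s r a → s :* r :* a := r :* (a :* s)) refl _ ρ _ ⟩
    ρ * (∏-ratio n * σ ^ N)                  ≈⟨ *-congˡ (∏-ratio*σ^q^n n) ⟩
    ρ * (∏θ ξ n * σ * R n)                   ≈⟨ solve 4 (λ r m s R → r :* (m :* s :* R) := m :* r :* s :* R) refl ρ _ σ _ ⟩
    ∏θ ξ n * ρ * σ * R n                     ≈⟨ *-congʳ (*-congʳ (ρ^q^n n eq)) ⟨
    ρ ^ N * σ * R n                          ≈⟨ *-congʳ (*-congʳ ρ^N) ⟩
    w ^ N * σ ^ N * σ * R n                  ≈⟨ *-congʳ (*-congˡ σ≈) ⟩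
    w ^ N * σ ^ N * (ρ * w⁻¹) * R n          ≈⟨ solve 5 (λ a s r i R → a :* s :* (r :* i) :* R := s :* r :* (i :* (a :* R))) refl _ _ ρ w⁻¹ _ ⟩
    σ ^ N * ρ * (w⁻¹ * (w ^ N * R n))        ∎)
    where
    N = q ℕ.^ n
    ρ^N : ρ ^ N ≈ w ^ N * σ ^ N
    ρ^N = trans (^-congˡ N (sym (trans (*-assoc _ _ _) (trans (*-congˡ (inverseˡ σ≉0)) (*-identityʳ ρ))))) (^-distrib-* w σ N)
    σ≈ : σ ≈ ρ * w⁻¹
    σ≈ = sym (trans (solve 3 (λ r s i → r :* (s :* i) := s :* (r :* i)) refl ρ σ _) (trans (*-congˡ (inverseʳ ρ≉0)) (*-identityʳ σ)))

  L : Carrier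
  L = - (π̃ / ρ)

  L≈w⁻¹*prod : L ≈ w⁻¹ * prod
  L≈w⁻¹*prod = sym (begin
    σ * ρ ⁻¹ * prod               ≈⟨ *-congʳ (*-congʳ σ≈-θroot) ⟩
    - (θ * root) * ρ ⁻¹ * prod    ≈⟨ solve 4 (λ θ r i p → :- (θ :* r) :* i :* p := :- (θ :* r :* p :* i)) refl θ root _ prod ⟩
    - (θ * root * prod * ρ ⁻¹)    ≈⟨ -‿cong (*-congʳ formula) ⟨
    - (π̃ * ρ ⁻¹)                  ∎)

  ∏-ratio-L : ∀ k → ∃[ n ] k ℕ.≤ n × Small k (∏-ratio n - L)
  ∏-ratio-L k = n , ℕ.≤-trans (ℕ.m≤n+m k N) N+k≤n , S-cong (begin
    w⁻¹ * ((w ^ (q ℕ.^ n) - 1#) * R n + (R n - prod))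
      ≈⟨ solve 4 (λ i w r p → i :* ((w :- con 1ℤ) :* r :+ (r :- p)) := i :* (w :* r) :- i :* p) refl w⁻¹ _ (R n) prod ⟩
    w⁻¹ * (w ^ (q ℕ.^ n) * R n) - w⁻¹ * prod
      ≈⟨ +-cong (∏-ratio≈ n (ξ^q^[rm]≈ξ (N ℕ.+ k))) (-‿cong L≈w⁻¹*prod) ⟨
    ∏-ratio n - L ∎)
    (S-*₀ S-w⁻¹ (S-+ (S-mono (ℕ.≤-trans (ℕ.m≤n+m k N) N+k≤n) (S-*₀ʳ (S-w^q^n-1 n) (S-R n)))
                     (proj₂ (R⇢prod k) n (ℕ.≤-trans (ℕ.m≤m+n N k) N+k≤n))))
    where
    N = proj₁ (R⇢prod k)
    -- A multiple of r, so that ξ^(q^n) = ξ, lying beyond both the threshold for `R` and k.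
    n = r ℕ.* (N ℕ.+ k)
    N+k≤n : N ℕ.+ k ℕ.≤ n
    N+k≤n = ℕ.m≤n*m (N ℕ.+ k) r {{ℕ.>-nonZero 0<r}}

  private
    Wordsₛ = MonicPolySetoid 𝔽q
  open Setoid Wordsₛ using () renaming (_≈_ to _≋_)
  open Membership Wordsₛ using (_∈_)
  open Unique Wordsₛ using (Unique)

  eval-cong : ∀ {as bs} x → as ≋ bs → ⟪ as ⟫ x ≈ ⟪ bs ⟫ x
  eval-cong x []             = refl
  eval-cong x (a≈b ∷ as≋bs) = +-cong (IsRingHomomorphism.⟦⟧-cong ι-hom a≈b) (*-congˡ (eval-cong x as≋bs))

  term-cong : term Preserves _≋_ ⟶ _≈_
  term-cong as≋bs = *-cong (eval-cong ξ monic≋) (⁻¹-cong (eval-cong θ monic≋))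
    where monic≋ = ListEquality.++⁺ 𝔽.setoid as≋bs (𝔽.refl ∷ [])

  S-term : ∀ as → Small (length as) (term as)
  S-term as = S-*₀ (S-eval (monic 𝔽q as) S-ξ) (S-monic⁻¹ as)

  -- An entry of `bs` of length at most n would repeat one of `words≤ n`; so all entries have degree
  -- above n ≥ k and small terms.
  S-∑-long : ∀ k n bs → k ℕ.≤ n → Unique (words≤ n ++ bs) → Small k (∑ bs term)
  S-∑-long k n bs k≤n words++bs! = S-∑ (All.tabulateₛ Wordsₛ S-long)
    where
    S-long : ∀ {as} → as ∈ bs → Small k (term as)
    S-long {as} as∈bs = S-mono (ℕ.≤-trans k≤n (ℕ.<⇒≤ (ℕ.≰⇒> λ |as|≤n →
      Sublist.unique-++⇒∉ Wordsₛ (words≤ n) words++bs! as∈bs (∈-words≤ n as |as|≤n)))) (S-term as)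

  S-∑-L : ∀ k n → k ℕ.≤ n → Small k (∏-ratio n - L) → ∀ as bs → Unique as →
          Permutation._↭_ Wordsₛ as (words≤ n ++ bs) → Small k (∑ as term - L)
  S-∑-L k n k≤n S-ratio as bs as! as↭ = S-cong (begin
    (∏-ratio n - L) + ∑ bs term           ≈⟨ solve 3 (λ a l b → (a :- l) :+ b := a :+ b :- l) refl (∏-ratio n) L _ ⟩
    ∏-ratio n + ∑ bs term - L             ≈⟨ +-congʳ (+-congʳ (∑-words≤ n)) ⟨
    ∑ (words≤ n) term + ∑ bs term - L     ≈⟨ +-congʳ (∑-++ (words≤ n) bs term) ⟨
    ∑ (words≤ n ++ bs) term - L           ≈⟨ +-congʳ (∑-↭ Wordsₛ term-cong as↭) ⟨
    ∑ as term - L                         ∎)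
    (S-+ S-ratio (S-∑-long k n bs k≤n (Permutationₚ.Unique-resp-↭ Wordsₛ as↭ as!)))

  isLValue : IsLValue ξ L
  isLValue bound =
    let k , -k≤bound = archimedean bound
        n , k≤n , S-ratio = ∏-ratio-L k
    -- One good n supplies the finite set of `IsFamilySum`; everything beyond it stays within the
    -- same bound.
    in words≤ n , λ as as! words⊆as →
      let bs , as↭ = Sublist.unique-⊆⇒↭ Wordsₛ (words≤! n) words⊆as
      in ≤₋-trans ℚ.≤-trans (Small.deg≤ (S-∑-L k n k≤n S-ratio as bs as! as↭)) [ -k≤bound ]

corollary2 : ∀ {c ℓ : Level} (p e : ℕ) → Prime p → 0 ℕ.< e →
    let q = p ℕ.^ e in
    (T : CarlitzTower c ℓ q) →
    let open Carlitz T in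
    (π̃ : Carrier) → IsFundamentalPeriod π̃ →
    (ξ : Carrier) → IsAlgebraic 𝔽q underlying ι ξ →
    (r : ℕ) → 0 ℕ.< r → ξ ^ (q ℕ.^ r) ≈ ξ →
    ∃[ s ] IsSCar π̃ s ×
    (∃[ ρ ] HasValueAt (τ s) ξ ρ
    × ¬ ρ ≈ 0#
    × ρ ^ (q ℕ.^ r ℕ.∸ 1) ≈ ∏< r (λ i → ξ - θ ^ (q ℕ.^ (r ℕ.∸ i)))
    × IsLValue ξ (- (π̃ / ρ)))
corollary2 p e _ _ T π̃ period ξ _ r 0<r ξ^q^r≈ξ =
  s , isSCar , ρ , ρ-value , ρ≉0 , ρ-equation , isLValue
  where
  open Period T period using (s; isSCar)
  open LValue T period 0<r ξ^q^r≈ξ using (ρ; ρ-value; ρ≉0; ρ-equation; isLValue)
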